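{- Let $n=2m+1$ be an odd positive integer with $m\ge 1$. Let $\mathcal{B}^*_n$ be the set of $n\times n$ matrices obtained from the matrices of $\mathcal{B}_{2m}$ by inserting, in each of them, a new row as row $m+1$ and a new column as column $m+1$, both $(0,1)$-vectors of size $2m+1$ whose only $1$ is in position $m+1$. Then $\mathcal{B}^*_n$ is a basis of the real vector space spanned by the $n\times n$ permutation matrices that are both symmetric and Hankel-symmetric, and this basis has size $\dim\Omega_n^{t\&h}-\frac{n-1}{2}+1$.
   Context: For a $k\times k$ matrix $X=[x_{ij}]$: $X^t$ is the transpose, the Hankel transpose $X^h$ has $(i,j)$ entry $x_{k+1-j,k+1-i}$, and $X^{\pi}$ has $(i,j)$ entry $x_{k+1-i,k+1-j}$; $X$ is symmetric if $X^t=X$, Hankel-symmetric if $X^h=X$. $\Omega_n^{t\&h}$ is the convex polytope of $n\times n$ doubly stochastic (nonnegative, all row and column sums $1$) matrices that are symmetric and Hankel-symmetric; its dimension is that of its affine hull. $O_m$ is the $m\times m$ zero matrix. For $1\le i<j\le m$, $T_m^{i,j}$ is the $m\times m$ permutation matrix of the transposition $(i,j)$ and $H_m^{i,j}$ is $T_m^{i,j}$ with the order of its columns reversed; $\tilde T_{2m}^{i,j}=\begin{bmatrix}T_m^{i,j}&O_m\\ O_m&(T_m^{i,j})^{\pi}\end{bmatrix}$ and $\tilde H_{2m}^{i,j}=\begin{bmatrix}O_m&H_m^{i,j}\\ (H_m^{i,j})^{\pi}&O_m\end{bmatrix}$. For $0\le i\le m$, $A_i$ is the $m\times m$ $(0,1)$-matrix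 whose only $1$'s are in positions $(1,1),\dots,(i,i)$, $B_i$ is the $m\times m$ $(0,1)$-matrix whose only $1$'s are in positions $(r,m+1-r)$ for $i<r\le m$, and $U_i=\begin{bmatrix}A_i&B_i\\ B_i^{\pi}&A_i^{\pi}\end{bmatrix}$. Finally $\mathcal{B}_{2m}=\{\tilde T_{2m}^{i,j}:1\le i<j\le m\}\cup\{\tilde H_{2m}^{i,j}:1\le i<j\le m\}\cup\{U_i:0\le i\le m\}$.
   Formalization: Matrix entries and scalars are rational instead of real: the span is the rational vector space spanned by the permutation matrices, and the dimension of Ω_n^{t&h} is that of its set of rational matrices. -}

module Defs where

open import Data.Nat as ℕ using (ℕ; zero; suc; _∸_; _<ᵇ_; _≤ᵇ_; _≡ᵇ_)
open import Data.Bool using (Bool; true; false; if_then_else_; _∧_; _∨_)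
open import Data.Fin using (Fin; toℕ; opposite)
open import Data.Fin.Permutation using (Permutation′; _⟨$⟩ʳ_)
open import Data.List using (List; []; _∷_; _++_; map; concatMap; upTo; length; lookup)
open import Data.Product using (Σ; ∃; _×_; _,_)
open import Data.Rational using (ℚ; 0ℚ; 1ℚ; _+_; _*_; _≤_)
open import Relation.Binary.PropositionalEquality using (_≡_)
open import Relation.Nullary using (¬_)

-- Real-valued k×k matrices are modelled with rational entries

Mat : ℕ → Set
Mat k = Fin k → Fin k → ℚ

_≈ₘ_ : ∀ {k} → Mat k → Mat k → Set
X ≈ₘ Y = ∀ r c → X r c ≡ Y r c

Oₘ : ∀ {k} → Mat k
Oₘ _ _ = 0ℚ

_+ₘ_ : ∀ {k} → Mat k → Mat k → Mat k
(X +ₘ Y) r c = X r c + Y r c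

_·ₘ_ : ∀ {k} → ℚ → Mat k → Mat k
(a ·ₘ X) r c = a * X r c

sumFin : ∀ {k} → (Fin k → ℚ) → ℚ
sumFin {zero}  f = 0ℚ
sumFin {suc k} f = f Data.Fin.zero + sumFin (λ i → f (Data.Fin.suc i))

sumMat : ∀ {k n} → (Fin k → Mat n) → Mat n
sumMat f r c = sumFin (λ i → f i r c)

Transpose : ∀ {k} → Mat k → Mat k
Transpose X r c = X c r

HankelTranspose : ∀ {k} → Mat k → Mat k
HankelTranspose X r c = X (opposite c) (opposite r)

Symmetric : ∀ {k} → Mat k → Set
Symmetric X = Transpose X ≈ₘ X

HankelSymmetric : ∀ {k} → Mat k → Set
HankelSymmetric X = HankelTranspose X ≈ₘ X

permMat : ∀ {k} → Permutation′ k → Mat k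
permMat σ r c with σ ⟨$⟩ʳ r Data.Fin.≟ c
... | Relation.Nullary.yes _ = 1ℚ
... | Relation.Nullary.no  _ = 0ℚ

SymHankPerm : ∀ {k} → Mat k → Set
SymHankPerm {k} X = Σ (Permutation′ k) λ σ → (permMat σ ≈ₘ X) × Symmetric X × HankelSymmetric X

DoublyStochastic : ∀ {k} → Mat k → Set
DoublyStochastic X =
  (∀ r c → 0ℚ ≤ X r c) × (∀ r → sumFin (λ c → X r c) ≡ 1ℚ) × (∀ c → sumFin (λ r → X r c) ≡ 1ℚ)

Ωth : ∀ k → Mat k → Set
Ωth k X = DoublyStochastic X × Symmetric X × HankelSymmetric X

combo : ∀ {k} (L : List (Mat k)) → (Fin (length L) → ℚ) → Mat k
combo L a = sumMat (λ i → a i ·ₘ lookup L i)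

InSpan : ∀ {k} → (Mat k → Set) → Mat k → Set
InSpan {k} S X = Σ ℕ λ p → Σ (Fin p → Mat k) λ v → (∀ i → S (v i)) ×
                 Σ (Fin p → ℚ) λ a → sumMat (λ i → a i ·ₘ v i) ≈ₘ X

LinearlyIndependent : ∀ {k} → List (Mat k) → Set
LinearlyIndependent L = ∀ a → combo L a ≈ₘ Oₘ → ∀ i → a i ≡ 0ℚ

IsBasisOfSpan : ∀ {k} → List (Mat k) → (Mat k → Set) → Set
IsBasisOfSpan {k} L S =
  (∀ i → InSpan S (lookup L i)) ×
  (∀ X → InSpan S X → Σ (Fin (length L) → ℚ) λ a → combo L a ≈ₘ X) ×
  LinearlyIndependent L

AffinelyIndependent : ∀ {p k} → (Fin p → Mat k) → Set
AffinelyIndependent v =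
  ∀ a → sumFin a ≡ 0ℚ → sumMat (λ i → a i ·ₘ v i) ≈ₘ Oₘ → ∀ i → a i ≡ 0ℚ

HasAffineDim : ∀ {k} → (Mat k → Set) → ℕ → Set
HasAffineDim {k} P d =
  (Σ (Fin (suc d) → Mat k) λ v → (∀ i → P (v i)) × AffinelyIndependent v) ×
  (∀ (v : Fin (suc (suc d)) → Mat k) → (∀ i → P (v i)) → ¬ AffinelyIndependent v)

-- The family B_{2m} as 0/1 matrices indexed by ℕ (0-based; only the
-- indices below the size matter).

RMat : Set
RMat = ℕ → ℕ → Bool

Oᵣ : RMat
Oᵣ _ _ = false

πᵣ : ℕ → RMat → RMat
πᵣ k X r c = X (k ∸ 1 ∸ r) (k ∸ 1 ∸ c)

swap : ℕ → ℕ → ℕ → ℕ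
swap i j r = if r ≡ᵇ i then j else (if r ≡ᵇ j then i else r)

Tᵣ : ℕ → ℕ → ℕ → RMat
Tᵣ m i j r c = swap i j r ≡ᵇ c

Hᵣ : ℕ → ℕ → ℕ → RMat
Hᵣ m i j r c = Tᵣ m i j r (m ∸ 1 ∸ c)

block : ℕ → RMat → RMat → RMat → RMat → RMat
block m P Q R S r c =
  if r <ᵇ m then (if c <ᵇ m then P r c else Q r (c ∸ m))
            else (if c <ᵇ m then R (r ∸ m) c else S (r ∸ m) (c ∸ m))

T̃ : ℕ → ℕ → ℕ → RMat
T̃ m i j = block m (Tᵣ m i j) Oᵣ Oᵣ (πᵣ m (Tᵣ m i j))

H̃ : ℕ → ℕ → ℕ → RMat
H̃ m i j = block m Oᵣ (Hᵣ m i j) (πᵣ m (Hᵣ m i j)) Oᵣ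

Aᵣ : ℕ → RMat
Aᵣ i r c = (r ≡ᵇ c) ∧ (r <ᵇ i)

Bᵣ : ℕ → ℕ → RMat
Bᵣ m i r c = (i ≤ᵇ r) ∧ (r <ᵇ m) ∧ (c ≡ᵇ (m ∸ 1 ∸ r))

Uᵣ : ℕ → ℕ → RMat
Uᵣ m i = block m (Aᵣ i) (Bᵣ m i) (πᵣ m (Bᵣ m i)) (πᵣ m (Aᵣ i))

pairs : ℕ → List (ℕ × ℕ)
pairs m = concatMap (λ j → map (λ i → (i , j)) (upTo j)) (upTo m)

𝓑 : ℕ → List RMat
𝓑 m = map (λ { (i , j) → T̃ m i j }) (pairs m)
   ++ map (λ { (i , j) → H̃ m i j }) (pairs m)
   ++ map (Uᵣ m) (upTo (suc m))

insertMid : ℕ → RMat → RMat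
insertMid m X r c =
  if (r ≡ᵇ m) ∨ (c ≡ᵇ m) then ((r ≡ᵇ m) ∧ (c ≡ᵇ m)) else X (shift r) (shift c)
  where
  shift : ℕ → ℕ
  shift x = if x <ᵇ m then x else x ∸ 1

toMat : ∀ {k} → RMat → Mat k
toMat X r c = if X (toℕ r) (toℕ c) then 1ℚ else 0ℚ

𝓑* : (m : ℕ) → List (Mat (suc (2 ℕ.* m)))
𝓑* m = map (λ X → toMat (insertMid m X)) (𝓑 m)

{-# OPTIONS --safe #-}
module Submission where

-- Each matrix of the family has an entry (its pivot) at which it is nonzero and all later matrices
-- vanish: (i,j) for T̃^{i,j}, the mirror image of (i,j) for H̃^{i,j}, and the antidiagonal position
-- of row k for U_k. Hence the family is independent, and eliminating pivots turns any matrix into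
-- one vanishing at all of them. A symmetric, Hankel-symmetric matrix with constant row sums that
-- vanishes at all pivots and in the middle column off the centre has at most diagonal entries left,
-- and comparing row sums with the (zero) middle row shows that it is 0.
-- Adjoining for each r ≤ m the average of the permutation matrices of the transpositions (r, centre)
-- and (n+1-r, centre), with pivot (r, centre), the same argument gives |𝓑*| + m independent points
-- of Ω spanning its linear hull, whose affine dimension is one less because row sums are 1.

open import Defs
open import Data.Bool using (Bool; true; false; if_then_else_; not; _∧_; _xor_)
import Data.Bool.Properties as Boolₚ
open import Data.Fin as Fin using (Fin; zero; suc; toℕ; opposite; punchIn; punchOut)
open import Data.Fin.Permutation using (Permutation′; permutation; _⟨$⟩ʳ_; _⟨$⟩ˡ_; inverseˡ)
open import Data.Fin.Permutation.Components using (transpose; transpose-inverse)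
import Data.Fin.Properties as Finₚ
import Data.Integer as ℤ
open import Data.List using (List; []; _∷_; _++_; map; length; lookup; upTo)
open import Data.List.Membership.Propositional using (_∈_)
import Data.List.Membership.Propositional.Properties as ∈ₚ
import Data.List.Properties as Listₚ
open import Data.List.Relation.Unary.All as All using (All; []; _∷_)
import Data.List.Relation.Unary.All.Properties as Allₚ
open import Data.List.Relation.Unary.AllPairs using (AllPairs; []; _∷_)
import Data.List.Relation.Unary.AllPairs.Properties as AllPairsₚ
open import Data.Nat using (ℕ; zero; suc; _+_; _*_; _∸_; _≤_; _<_; _<?_; _≤?_; _≟_; z≤n; s≤s; _≡ᵇ_; _≤ᵇ_; _<ᵇ_)
import Data.Nat.Properties as ℕₚ
open import Data.Product using (Σ; ∃; _×_; _,_; proj₁; proj₂; uncurry)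
open import Data.Rational as ℚ using (ℚ; 0ℚ; 1ℚ; ½)
import Data.Rational.Properties as ℚₚ
open import Data.Rational.Solver using (module +-*-Solver)
open import Data.Sum using (inj₁; inj₂)
open import Function using (_∘_; id)
open import Relation.Binary.Definitions using (tri<; tri≈; tri>)
open import Relation.Binary.PropositionalEquality
open import Relation.Nullary using (¬_; yes; no; does; contradiction)
open import Relation.Nullary.Decidable using (dec-true; dec-false)
open +-*-Solver using (solve; _:+_; _:*_; :-_; _:=_)

-- Linear algebra over ℚ

sumFin-cong : ∀ {k} {f g : Fin k → ℚ} → (∀ i → f i ≡ g i) → sumFin f ≡ sumFin g
sumFin-cong {zero}  eq = refl
sumFin-cong {suc k} eq = cong₂ ℚ._+_ (eq zero) (sumFin-cong (eq ∘ suc))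

sumFin-zero : ∀ {k} {f : Fin k → ℚ} → (∀ i → f i ≡ 0ℚ) → sumFin f ≡ 0ℚ
sumFin-zero {zero}  eq = refl
sumFin-zero {suc k} eq = cong₂ ℚ._+_ (eq zero) (sumFin-zero (eq ∘ suc))

sumFin-+ : ∀ {k} (f g : Fin k → ℚ) → sumFin (λ i → f i ℚ.+ g i) ≡ sumFin f ℚ.+ sumFin g
sumFin-+ {zero}  f g = refl
sumFin-+ {suc k} f g = trans (cong (f zero ℚ.+ g zero ℚ.+_) (sumFin-+ (f ∘ suc) (g ∘ suc)))
  (solve 4 (λ a b c d → (a :+ b) :+ (c :+ d) := (a :+ c) :+ (b :+ d)) refl
    (f zero) (g zero) (sumFin (f ∘ suc)) (sumFin (g ∘ suc)))

sumFin-*ˡ : ∀ {k} a (f : Fin k → ℚ) → sumFin (λ i → a ℚ.* f i) ≡ a ℚ.* sumFin f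
sumFin-*ˡ {zero}  a f = sym (ℚₚ.*-zeroʳ a)
sumFin-*ˡ {suc k} a f = trans (cong (a ℚ.* f zero ℚ.+_) (sumFin-*ˡ a (f ∘ suc))) (sym (ℚₚ.*-distribˡ-+ a (f zero) (sumFin (f ∘ suc))))

sumFin-*ʳ : ∀ {k} a (f : Fin k → ℚ) → sumFin (λ i → f i ℚ.* a) ≡ sumFin f ℚ.* a
sumFin-*ʳ a f = trans (sumFin-cong λ i → ℚₚ.*-comm (f i) a) (trans (sumFin-*ˡ a f) (ℚₚ.*-comm a _))

sumFin-swap : ∀ {k l} (f : Fin k → Fin l → ℚ) →
  sumFin (λ i → sumFin (f i)) ≡ sumFin (λ j → sumFin (λ i → f i j))
sumFin-swap {zero} {l} f = sym (sumFin-zero {l} λ _ → refl)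
sumFin-swap {suc k} f = trans (cong (sumFin (f zero) ℚ.+_) (sumFin-swap (f ∘ suc)))
  (sym (sumFin-+ (f zero) (λ j → sumFin (λ i → f (suc i) j))))

sumFin-single : ∀ {k} {f : Fin k → ℚ} d → (∀ i → i ≢ d → f i ≡ 0ℚ) → sumFin f ≡ f d
sumFin-single {f = f} zero    off =
  trans (cong (f zero ℚ.+_) (sumFin-zero λ i → off (suc i) λ ())) (ℚₚ.+-identityʳ _)
sumFin-single (suc d) off =
  trans (cong₂ ℚ._+_ (off zero λ ()) (sumFin-single d λ i i≢d → off (suc i) (i≢d ∘ Finₚ.suc-injective)))
        (ℚₚ.+-identityˡ _)

*-cancel-zero : ∀ a {p} → p ≢ 0ℚ → a ℚ.* p ≡ 0ℚ → a ≡ 0ℚ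
*-cancel-zero a {p} p≢0 eq = begin
  a                        ≡⟨ ℚₚ.*-identityʳ a ⟨
  a ℚ.* 1ℚ                 ≡⟨ cong (a ℚ.*_) (ℚₚ.*-inverseʳ p) ⟨
  a ℚ.* (p ℚ.* (ℚ.1/ p))   ≡⟨ ℚₚ.*-assoc a p _ ⟨
  a ℚ.* p ℚ.* (ℚ.1/ p)     ≡⟨ cong (ℚ._* (ℚ.1/ p)) eq ⟩
  0ℚ ℚ.* (ℚ.1/ p)          ≡⟨ ℚₚ.*-zeroˡ (ℚ.1/ p) ⟩
  0ℚ                       ∎
  where
  open ≡-Reasoning
  instance _ = ℚ.≢-nonZero p≢0

-- Row 0 is used to clear one column in which it is nonzero.
rows-dependent : ∀ {k} (C : Fin (suc k) → Fin k → ℚ) →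
  Σ (Fin (suc k) → ℚ) λ a → (∃ λ i → a i ≢ 0ℚ) × (∀ j → sumFin (λ i → a i ℚ.* C i j) ≡ 0ℚ)
rows-dependent {zero}  C = (λ _ → 1ℚ) , (zero , λ ()) , λ ()
rows-dependent {suc k} C with Finₚ.all? (λ j → C zero j ℚ.≟ 0ℚ)
... | yes row≡0 = unit , (zero , λ ()) , λ j →
        trans (sumFin-single {f = λ i → unit i ℚ.* C i j} zero λ
                 { zero 0≢0 → contradiction refl 0≢0 ; (suc i) _ → ℚₚ.*-zeroˡ (C (suc i) j) })
              (trans (ℚₚ.*-identityˡ _) (row≡0 j))
  where
  unit : Fin (suc (suc k)) → ℚ
  unit zero    = 1ℚ
  unit (suc _) = 0ℚ
... | no row≢0 with Finₚ.¬∀⟶∃¬ _ _ (λ j → C zero j ℚ.≟ 0ℚ) row≢0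
...   | j₀ , pivot≢0 = a , (suc (proj₁ nz) , proj₂ nz) , vanish
  where
  instance _ = ℚ.≢-nonZero pivot≢0
  ratio : Fin (suc k) → ℚ
  ratio i = C (suc i) j₀ ℚ.* (ℚ.1/ C zero j₀)
  reduced : Fin (suc k) → Fin (suc k) → ℚ
  reduced i j = C (suc i) j ℚ.+ ratio i ℚ.* (ℚ.- C zero j)
  -- Row 0 and the cleared column `j₀` are dropped, so there is again one row more than columns.
  ih = rows-dependent (λ i l → reduced i (punchIn j₀ l))
  a′ = proj₁ ih
  nz = proj₁ (proj₂ ih)
  a : Fin (suc (suc k)) → ℚ
  -- Collects the multiples of row 0 that were subtracted from the other rows in `reduced`.
  a zero    = ℚ.- sumFin (λ i → a′ i ℚ.* ratio i)
  a (suc i) = a′ i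
  reduce : ∀ j → sumFin (λ i → a i ℚ.* C i j) ≡ sumFin (λ i → a′ i ℚ.* reduced i j)
  reduce j = sym (begin
    sumFin (λ i → a′ i ℚ.* reduced i j)
      ≡⟨ sumFin-cong (λ i → solve 4 (λ a c r z → a :* (c :+ r :* (:- z)) := a :* r :* (:- z) :+ a :* c) refl
                              (a′ i) (C (suc i) j) (ratio i) (C zero j)) ⟩
    sumFin (λ i → a′ i ℚ.* ratio i ℚ.* (ℚ.- C zero j) ℚ.+ a′ i ℚ.* C (suc i) j)
      ≡⟨ sumFin-+ (λ i → a′ i ℚ.* ratio i ℚ.* (ℚ.- C zero j)) (λ i → a′ i ℚ.* C (suc i) j) ⟩
    sumFin (λ i → a′ i ℚ.* ratio i ℚ.* (ℚ.- C zero j)) ℚ.+ rest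
      ≡⟨ cong (ℚ._+ rest) (sumFin-*ʳ (ℚ.- C zero j) (λ i → a′ i ℚ.* ratio i)) ⟩
    sumFin (λ i → a′ i ℚ.* ratio i) ℚ.* (ℚ.- C zero j) ℚ.+ rest
      ≡⟨ cong (ℚ._+ rest) (solve 2 (λ s z → s :* (:- z) := (:- s) :* z) refl
                             (sumFin (λ i → a′ i ℚ.* ratio i)) (C zero j)) ⟩
    a zero ℚ.* C zero j ℚ.+ rest ∎)
    where
    open ≡-Reasoning
    rest = sumFin (λ i → a′ i ℚ.* C (suc i) j)
  reduced-pivot : ∀ i → reduced i j₀ ≡ 0ℚ
  reduced-pivot i = begin
    c ℚ.+ c ℚ.* q ℚ.* (ℚ.- p)   ≡⟨ solve 3 (λ c q p → c :+ c :* q :* (:- p) := c :+ (:- (c :* (q :* p)))) refl c q p ⟩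
    c ℚ.+ ℚ.- (c ℚ.* (q ℚ.* p)) ≡⟨ cong (λ t → c ℚ.+ ℚ.- (c ℚ.* t)) (ℚₚ.*-inverseˡ p) ⟩
    c ℚ.+ ℚ.- (c ℚ.* 1ℚ)        ≡⟨ cong (λ t → c ℚ.+ ℚ.- t) (ℚₚ.*-identityʳ c) ⟩
    c ℚ.+ ℚ.- c                 ≡⟨ ℚₚ.+-inverseʳ c ⟩
    0ℚ                          ∎
    where
    open ≡-Reasoning
    c = C (suc i) j₀
    p = C zero j₀
    q = ℚ.1/ C zero j₀
  vanish : ∀ j → sumFin (λ i → a i ℚ.* C i j) ≡ 0ℚ
  vanish j with j₀ Fin.≟ j
  ... | yes refl = trans (reduce j) (sumFin-zero λ i →
                     trans (cong (a′ i ℚ.*_) (reduced-pivot i)) (ℚₚ.*-zeroʳ (a′ i)))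
  ... | no j₀≢j  = trans (reduce j) (trans
                     (sumFin-cong λ i → cong (λ t → a′ i ℚ.* reduced i t) (sym (Finₚ.punchIn-punchOut j₀≢j)))
                     (proj₂ (proj₂ ih) (punchOut j₀≢j)))

-- Echelon families and elimination of pivots

combo-vanish : ∀ {k} (L : List (Mat k)) a {r c} → All (λ X → X r c ≡ 0ℚ) L → combo L a r c ≡ 0ℚ
combo-vanish []      a []       = refl
combo-vanish (X ∷ L) a (z ∷ zs) = cong₂ ℚ._+_
  (trans (cong (a zero ℚ.*_) z) (ℚₚ.*-zeroʳ (a zero))) (combo-vanish L (a ∘ suc) zs)

module Elimination {n} {A : Set} (g : A → Mat n) (row col : A → Fin n) where

  -- The array of values of the family at its pivots is triangular with nonzero diagonal.
  Echelon : List A → Set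
  Echelon L = All (λ x → g x (row x) (col x) ≢ 0ℚ) L × AllPairs (λ x y → g y (row x) (col x) ≡ 0ℚ) L

  private
    allMap : ∀ {L : List A} {r c} → All (λ y → g y r c ≡ 0ℚ) L → All (λ X → X r c ≡ 0ℚ) (map g L)
    allMap []       = []
    allMap (z ∷ zs) = z ∷ allMap zs

  -- Forward substitution: at the first pivot only the first term survives, so its coefficient is 0
  -- and a relation among the tail is left.
  echelon⇒independent : ∀ L → Echelon L → LinearlyIndependent (map g L)
  echelon⇒independent (x ∷ L) (p ∷ ps , z ∷ zs) a eq = coeff
    where
    head≡0 : a zero ≡ 0ℚ
    head≡0 = *-cancel-zero (a zero) p (trans (sym (trans
      (cong (a zero ℚ.* g x (row x) (col x) ℚ.+_) (combo-vanish (map g L) (a ∘ suc) (allMap z)))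
      (ℚₚ.+-identityʳ _))) (eq (row x) (col x)))
    tail-eq : combo (map g L) (a ∘ suc) ≈ₘ Oₘ
    tail-eq r c = trans (sym (trans
      (cong (ℚ._+ combo (map g L) (a ∘ suc) r c) (trans (cong (ℚ._* g x r c) head≡0) (ℚₚ.*-zeroˡ (g x r c))))
      (ℚₚ.+-identityˡ _))) (eq r c)
    coeff : ∀ i → a i ≡ 0ℚ
    coeff zero    = head≡0
    coeff (suc i) = echelon⇒independent L (ps , zs) (a ∘ suc) tail-eq i

  -- Gaussian elimination in list order. `W` stands for a space closed under adding multiples of the
  -- family, so that the remainder `R` stays in it.
  eliminate : (W : Mat n → Set) (ok : A → Set) →
    (∀ {X x} b → ok x → W X → W (X +ₘ (b ·ₘ g x))) →
    ∀ L → Echelon L → All ok L → ∀ X → W X →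
    Σ (Fin (length (map g L)) → ℚ) λ a → Σ (Mat n) λ R →
      W R × All (λ x → R (row x) (col x) ≡ 0ℚ) L × (∀ r c → combo (map g L) a r c ℚ.+ R r c ≡ X r c)
  eliminate W ok step [] _ _ X wX = (λ ()) , X , wX , [] , λ r c → ℚₚ.+-identityˡ _
  eliminate W ok step (x ∷ L) (p ∷ ps , z ∷ zs) (o ∷ os) X wX
    with eliminate W ok step L (ps , zs) os (X +ₘ ((ℚ.- b) ·ₘ g x)) (step (ℚ.- b) o wX)
    where
    b = X (row x) (col x) ℚ.* (ℚ.1/ g x (row x) (col x)) {{ℚ.≢-nonZero p}}
  ... | a′ , R , wR , piv , eq = a , R , wR , head ∷ piv , total
    where
    instance _ = ℚ.≢-nonZero p
    π = g x (row x) (col x)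
    ξ = X (row x) (col x)
    b = ξ ℚ.* (ℚ.1/ π)
    a : Fin (suc (length (map g L))) → ℚ
    a zero    = b
    a (suc i) = a′ i
    -- Clearing the later pivots does not disturb this one, because all later matrices vanish at it.
    head : R (row x) (col x) ≡ 0ℚ
    head = begin
      R (row x) (col x)             ≡⟨ ℚₚ.+-identityˡ _ ⟨
      0ℚ ℚ.+ R (row x) (col x)      ≡⟨ cong (ℚ._+ R (row x) (col x)) (combo-vanish (map g L) a′ (allMap z)) ⟨
      _                             ≡⟨ eq (row x) (col x) ⟩
      ξ ℚ.+ (ℚ.- b) ℚ.* π           ≡⟨ solve 3 (λ x q p → x :+ (:- (x :* q)) :* p := x :+ (:- (x :* (q :* p)))) refl ξ (ℚ.1/ π) π ⟩
      ξ ℚ.+ ℚ.- (ξ ℚ.* ((ℚ.1/ π) ℚ.* π)) ≡⟨ cong (λ t → ξ ℚ.+ ℚ.- (ξ ℚ.* t)) (ℚₚ.*-inverseˡ π) ⟩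
      ξ ℚ.+ ℚ.- (ξ ℚ.* 1ℚ)          ≡⟨ cong (λ t → ξ ℚ.+ ℚ.- t) (ℚₚ.*-identityʳ ξ) ⟩
      ξ ℚ.+ ℚ.- ξ                   ≡⟨ ℚₚ.+-inverseʳ ξ ⟩
      0ℚ                            ∎
      where open ≡-Reasoning
    total : ∀ r c → combo (g x ∷ map g L) a r c ℚ.+ R r c ≡ X r c
    total r c = begin
      (b ℚ.* y ℚ.+ t) ℚ.+ R r c             ≡⟨ ℚₚ.+-assoc (b ℚ.* y) t (R r c) ⟩
      b ℚ.* y ℚ.+ (t ℚ.+ R r c)             ≡⟨ cong (b ℚ.* y ℚ.+_) (eq r c) ⟩
      b ℚ.* y ℚ.+ (X r c ℚ.+ (ℚ.- b) ℚ.* y) ≡⟨ solve 3 (λ b y x → b :* y :+ (x :+ (:- b) :* y) := x) refl b y (X r c) ⟩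
      X r c                                 ∎
      where
      open ≡-Reasoning
      y = g x r c
      t = combo (map g L) a′ r c

  -- Reduces spanning to a uniqueness question: the remainder of the elimination lies in `W` and
  -- vanishes at every pivot.
  echelon⇒spans : (W : Mat n → Set) (ok : A → Set) →
    (∀ {X x} b → ok x → W X → W (X +ₘ (b ·ₘ g x))) →
    ∀ L → Echelon L → All ok L →
    (∀ R → W R → All (λ x → R (row x) (col x) ≡ 0ℚ) L → R ≈ₘ Oₘ) →
    ∀ X → W X → Σ (Fin (length (map g L)) → ℚ) λ a → combo (map g L) a ≈ₘ X
  echelon⇒spans W ok step L ech oks vanish X wX with eliminate W ok step L ech oks X wX
  ... | a , R , wR , piv , eq = a , λ r c → trans (sym (trans
    (cong (combo (map g L) a r c ℚ.+_) (vanish R wR piv r c)) (ℚₚ.+-identityʳ _))) (eq r c)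

-- A unit row sum turns a linear dependence into an affine one.
affineDim : ∀ {k K d} {P : Mat (suc k) → Set} (F : Fin K → Mat (suc k)) → K ≡ suc d →
  (∀ i → P (F i)) →
  (∀ (a : Fin K → ℚ) → sumMat (λ i → a i ·ₘ F i) ≈ₘ Oₘ → ∀ i → a i ≡ 0ℚ) →
  (∀ X → P X → Σ (Fin K → ℚ) λ a → sumMat (λ i → a i ·ₘ F i) ≈ₘ X) →
  (∀ X → P X → sumFin (X zero) ≡ 1ℚ) →
  HasAffineDim P d
affineDim {d = d} {P} F refl inP indep span rowSum = (F , inP , λ a _ → indep a) , dependent
  where
  dependent : ∀ v → (∀ i → P (v i)) → ¬ AffinelyIndependent v
  dependent v pv ai = nz (ai a Σa≡0 Σav≡0 i₀)
    where
    -- Coordinates of the d+2 points with respect to the d+1 members of `F`: one row more than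
    -- columns, hence a dependence.
    C = λ i → proj₁ (span (v i) (pv i))
    dep = rows-dependent C
    a = proj₁ dep
    i₀ = proj₁ (proj₁ (proj₂ dep))
    nz = proj₂ (proj₁ (proj₂ dep))
    open ≡-Reasoning
    Σav≡0 : sumMat (λ i → a i ·ₘ v i) ≈ₘ Oₘ
    Σav≡0 r c = begin
      sumFin (λ i → a i ℚ.* v i r c)
        ≡⟨ sumFin-cong (λ i → cong (a i ℚ.*_) (sym (proj₂ (span (v i) (pv i)) r c))) ⟩
      sumFin (λ i → a i ℚ.* sumFin (λ j → C i j ℚ.* F j r c))
        ≡⟨ sumFin-cong (λ i → sym (sumFin-*ˡ (a i) (λ j → C i j ℚ.* F j r c))) ⟩
      sumFin (λ i → sumFin (λ j → a i ℚ.* (C i j ℚ.* F j r c)))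
        ≡⟨ sumFin-swap (λ i j → a i ℚ.* (C i j ℚ.* F j r c)) ⟩
      sumFin (λ j → sumFin (λ i → a i ℚ.* (C i j ℚ.* F j r c)))
        ≡⟨ sumFin-zero (λ j → begin
             sumFin (λ i → a i ℚ.* (C i j ℚ.* F j r c)) ≡⟨ sumFin-cong (λ i → ℚₚ.*-assoc (a i) (C i j) (F j r c)) ⟨
             sumFin (λ i → a i ℚ.* C i j ℚ.* F j r c)   ≡⟨ sumFin-*ʳ (F j r c) (λ i → a i ℚ.* C i j) ⟩
             sumFin (λ i → a i ℚ.* C i j) ℚ.* F j r c   ≡⟨ cong (ℚ._* F j r c) (proj₂ (proj₂ dep) j) ⟩
             0ℚ ℚ.* F j r c                             ≡⟨ ℚₚ.*-zeroˡ (F j r c) ⟩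
             0ℚ                                         ∎) ⟩
      0ℚ ∎
    Σa≡0 : sumFin a ≡ 0ℚ
    Σa≡0 = begin
      sumFin a
        ≡⟨ sumFin-cong (λ i → trans (sym (ℚₚ.*-identityʳ (a i))) (cong (a i ℚ.*_) (sym (rowSum (v i) (pv i))))) ⟩
      sumFin (λ i → a i ℚ.* sumFin (v i zero))
        ≡⟨ sumFin-cong (λ i → sym (sumFin-*ˡ (a i) (v i zero))) ⟩
      sumFin (λ i → sumFin (λ c → a i ℚ.* v i zero c))
        ≡⟨ sumFin-swap (λ i c → a i ℚ.* v i zero c) ⟩
      sumFin (λ c → sumFin (λ i → a i ℚ.* v i zero c))
        ≡⟨ sumFin-zero (Σav≡0 zero) ⟩
      0ℚ ∎

-- Symmetric permutation matrices

-- Matrix of a plain function. The Boolean test makes its entries directly comparable with those of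
-- `toMat`.
δ : ∀ {k} → (Fin k → Fin k) → Mat k
δ f r c = if does (f r Fin.≟ c) then 1ℚ else 0ℚ

δ-one : ∀ {k} (f : Fin k → Fin k) {r c} → f r ≡ c → δ f r c ≡ 1ℚ
δ-one f {r} {c} eq rewrite dec-true (f r Fin.≟ c) eq = refl

δ-zero : ∀ {k} (f : Fin k → Fin k) {r c} → f r ≢ c → δ f r c ≡ 0ℚ
δ-zero f {r} {c} neq rewrite dec-false (f r Fin.≟ c) neq = refl

δ-nonzero : ∀ {k} (f : Fin k → Fin k) {r c} → δ f r c ≢ 0ℚ → f r ≡ c
δ-nonzero f {r} {c} ≢0 with f r Fin.≟ c
... | yes eq = eq
... | no  _  = contradiction refl ≢0

δ-nonneg : ∀ {k} (f : Fin k → Fin k) r c → 0ℚ ℚ.≤ δ f r c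
δ-nonneg f r c with does (f r Fin.≟ c)
... | true  = ℚ.*≤* (ℤ.+≤+ z≤n)
... | false = ℚₚ.≤-refl

δ-rowSum : ∀ {k} (f : Fin k → Fin k) r → sumFin (δ f r) ≡ 1ℚ
δ-rowSum f r = trans (sumFin-single (f r) λ c c≢ → δ-zero f (c≢ ∘ sym)) (δ-one f refl)

δ-cong : ∀ {k} (f g : Fin k → Fin k) {r c r′ c′} →
  (f r ≡ c → g r′ ≡ c′) → (g r′ ≡ c′ → f r ≡ c) → δ f r c ≡ δ g r′ c′
δ-cong f g {r} {c} to from with f r Fin.≟ c
... | yes eq = sym (δ-one g (to eq))
... | no neq = sym (δ-zero g (neq ∘ from))

-- For an involution, f r = c exactly when f c = r.
δ-symmetric : ∀ {k} (f : Fin k → Fin k) → (∀ x → f (f x) ≡ x) → Symmetric (δ f)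
δ-symmetric f inv r c = δ-cong f f (λ { refl → inv c }) (λ { refl → inv r })

permMat≈δ : ∀ {k} (σ : Permutation′ k) → permMat σ ≈ₘ δ (σ ⟨$⟩ʳ_)
permMat≈δ σ r c with σ ⟨$⟩ʳ r Fin.≟ c
... | yes _ = refl
... | no  _ = refl

opposite-injective : ∀ {k} {x y : Fin k} → opposite x ≡ opposite y → x ≡ y
opposite-injective {x = x} {y} eq =
  trans (sym (Finₚ.opposite-involutive x)) (trans (cong opposite eq) (Finₚ.opposite-involutive y))

-- Conjugation by the reversal; on matrices of involutions it is the Hankel transpose.
conjugate : ∀ {k} → (Fin k → Fin k) → Fin k → Fin k
conjugate f = opposite ∘ f ∘ opposite

conjugate-involutive : ∀ {k} (f : Fin k → Fin k) → (∀ x → f (f x) ≡ x) → ∀ x → conjugate f (conjugate f x) ≡ x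
conjugate-involutive f inv x = begin
  opposite (f (opposite (opposite (f (opposite x))))) ≡⟨ cong (opposite ∘ f) (Finₚ.opposite-involutive _) ⟩
  opposite (f (f (opposite x)))                       ≡⟨ cong opposite (inv _) ⟩
  opposite (opposite x)                               ≡⟨ Finₚ.opposite-involutive x ⟩
  x                                                   ∎
  where open ≡-Reasoning

δ-conjugate : ∀ {k} (f : Fin k → Fin k) → (∀ x → f (f x) ≡ x) → HankelTranspose (δ f) ≈ₘ δ (conjugate f)
δ-conjugate f inv r c = δ-cong f (conjugate f)
  (λ eq → trans (cong (opposite ∘ f) (sym eq)) (trans (cong opposite (inv _)) (Finₚ.opposite-involutive c)))
  (λ { refl → trans (cong f (Finₚ.opposite-involutive _)) (inv _) })

-- Positions as a side of the centre and a distance from the border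

module Positions (m : ℕ) where

  N : ℕ
  N = suc (2 * m)

  2m≡m+m : 2 * m ≡ m + m
  2m≡m+m = cong (m +_) (ℕₚ.+-identityʳ m)

  m≤2m : m ≤ 2 * m
  m≤2m = ℕₚ.m≤m+n m (m + 0)

  -- Truncated at 2m; only the positions i ≤ m are used.
  abstract
    lo : ℕ → Fin N
    lo i = Fin.fromℕ< (s≤s (ℕₚ.m⊓n≤n i (2 * m)))

    toℕ-lo : ∀ {i} → i ≤ m → toℕ (lo i) ≡ i
    toℕ-lo i≤m = trans (Finₚ.toℕ-fromℕ< _) (ℕₚ.m≤n⇒m⊓n≡m (ℕₚ.≤-trans i≤m m≤2m))

  hi : ℕ → Fin N
  hi i = opposite (lo i)

  -- Mirroring negates the Boolean. The centre, at distance m, carries both signs.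
  place : Bool → ℕ → Fin N
  place false = lo
  place true  = hi

  toℕ-hi : ∀ {i} → i ≤ m → toℕ (hi i) ≡ 2 * m ∸ i
  toℕ-hi {i} i≤m = trans (Finₚ.opposite-prop (lo i)) (cong (2 * m ∸_) (toℕ-lo i≤m))

  opposite-place : ∀ s i → opposite (place s i) ≡ place (not s) i
  opposite-place false i = refl
  opposite-place true  i = Finₚ.opposite-involutive (lo i)

  2m∸m≡m : 2 * m ∸ m ≡ m
  2m∸m≡m = trans (cong (_∸ m) 2m≡m+m) (ℕₚ.m+n∸n≡m m m)

  place-mid : ∀ s → place s m ≡ lo m
  place-mid false = refl
  place-mid true  = Finₚ.toℕ-injective
    (trans (toℕ-hi ℕₚ.≤-refl) (trans 2m∸m≡m (sym (toℕ-lo ℕₚ.≤-refl))))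

  cover : ∀ x → Σ Bool λ s → Σ ℕ λ i → i ≤ m × x ≡ place s i
  cover x with toℕ x ≤? m
  ... | yes x≤m = false , toℕ x , x≤m , Finₚ.toℕ-injective (sym (toℕ-lo x≤m))
  ... | no  x≰m = true , toℕ (opposite x) , x′≤m ,
          trans (sym (Finₚ.opposite-involutive x)) (cong opposite (Finₚ.toℕ-injective (sym (toℕ-lo x′≤m))))
    where
    x′≤m : toℕ (opposite x) ≤ m
    x′≤m = subst₂ _≤_ (sym (Finₚ.opposite-prop x)) 2m∸m≡m (ℕₚ.∸-monoʳ-≤ (2 * m) (ℕₚ.≰⇒≥ x≰m))

  -- The two halves meet only in the centre: i ≤ m ≤ 2m - j forces equality throughout.
  lo≡hi⇒mid : ∀ {i j} → i ≤ m → j ≤ m → lo i ≡ hi j → i ≡ m × j ≡ m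
  lo≡hi⇒mid {i} {j} i≤m j≤m eq = i≡m , j≡m
    where
    i≡2m∸j : i ≡ 2 * m ∸ j
    i≡2m∸j = trans (sym (toℕ-lo i≤m)) (trans (cong toℕ eq) (toℕ-hi j≤m))
    i≡m : i ≡ m
    i≡m = ℕₚ.≤-antisym i≤m (subst₂ _≤_ 2m∸m≡m (sym i≡2m∸j) (ℕₚ.∸-monoʳ-≤ (2 * m) j≤m))
    j≡m : j ≡ m
    j≡m = ℕₚ.∸-cancelˡ-≡ (ℕₚ.≤-trans j≤m m≤2m) m≤2m (trans (sym i≡2m∸j) (trans i≡m (sym 2m∸m≡m)))

  lo-injective : ∀ {i j} → i ≤ m → j ≤ m → lo i ≡ lo j → i ≡ j
  lo-injective i≤m j≤m eq = trans (sym (toℕ-lo i≤m)) (trans (cong toℕ eq) (toℕ-lo j≤m))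

  place-injective : ∀ s t {i j} → i ≤ m → j ≤ m → place s i ≡ place t j → i ≡ j × (i < m → s ≡ t)
  place-injective false false i≤m j≤m eq = lo-injective i≤m j≤m eq , λ _ → refl
  place-injective true  true  i≤m j≤m eq = lo-injective i≤m j≤m (opposite-injective eq) , λ _ → refl
  place-injective false true  i≤m j≤m eq with lo≡hi⇒mid i≤m j≤m eq
  ... | refl , refl = refl , λ m<m → contradiction m<m (ℕₚ.<-irrefl refl)
  place-injective true  false i≤m j≤m eq with lo≡hi⇒mid j≤m i≤m (sym eq)
  ... | refl , refl = refl , λ m<m → contradiction m<m (ℕₚ.<-irrefl refl)

  -- The involutions of {1,…,n} commuting with the reversal that are needed here: apply τ to the
  -- distance from the border, and reflect the positions i with flip i = true.
  record Signed : Set where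
    field
      τ      : ℕ → ℕ
      flip   : ℕ → Bool
      τ-<    : ∀ {i} → i < m → τ i < m
      τ-mid  : τ m ≡ m
      τ-inv  : ∀ i → τ (τ i) ≡ i
      flip-τ : ∀ i → flip (τ i) ≡ flip i

    τ-≤ : ∀ {i} → i ≤ m → τ i ≤ m
    τ-≤ i≤m with ℕₚ.m≤n⇒m<n∨m≡n i≤m
    ... | inj₁ i<m  = ℕₚ.<⇒≤ (τ-< i<m)
    ... | inj₂ refl = ℕₚ.≤-reflexive τ-mid

    abstract
      act : Fin N → Fin N
      act x with cover x
      ... | s , i , _ = place (s xor flip i) (τ i)

      -- At the centre the sign found by `cover` may differ from `s`; this is harmless because `τ`
      -- fixes m and both signs name the same position there.
      act-place : ∀ s {i} → i ≤ m → act (place s i) ≡ place (s xor flip i) (τ i)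
      act-place s {i} i≤m with cover (place s i)
      ... | t , j , j≤m , eq with place-injective s t i≤m j≤m eq | ℕₚ.m≤n⇒m<n∨m≡n i≤m
      ...   | refl , s≡t | inj₁ i<m rewrite s≡t i<m = refl
      ...   | refl , s≡t | inj₂ refl rewrite τ-mid = trans (place-mid (t xor flip m)) (sym (place-mid (s xor flip m)))

    -- `flip` is constant on the orbits of `τ`, so the second reflection undoes the first.
    act-involutive : ∀ x → act (act x) ≡ x
    act-involutive x with cover x
    ... | s , i , i≤m , refl = begin
      act (act (place s i))                                    ≡⟨ cong act (act-place s i≤m) ⟩
      act (place (s xor flip i) (τ i))                         ≡⟨ act-place (s xor flip i) (τ-≤ i≤m) ⟩
      place ((s xor flip i) xor flip (τ i)) (τ (τ i))          ≡⟨ cong₂ place (cong ((s xor flip i) xor_) (flip-τ i)) (τ-inv i) ⟩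
      place ((s xor flip i) xor flip i) i                      ≡⟨ cong (λ u → place u i) (xor-cancel s (flip i)) ⟩
      place s i                                                ∎
      where
      open ≡-Reasoning
      xor-cancel : ∀ s b → (s xor b) xor b ≡ s
      xor-cancel s b = trans (Boolₚ.xor-assoc s b b) (trans (cong (s xor_) (Boolₚ.xor-same b)) (Boolₚ.xor-identityʳ s))

    act-opposite : ∀ x → act (opposite x) ≡ opposite (act x)
    act-opposite x with cover x
    ... | s , i , i≤m , refl = begin
      act (opposite (place s i))            ≡⟨ cong act (opposite-place s i) ⟩
      act (place (not s) i)                 ≡⟨ act-place (not s) i≤m ⟩
      place (not s xor flip i) (τ i)        ≡⟨ cong (λ u → place u (τ i)) (Boolₚ.not-distribˡ-xor s (flip i)) ⟨
      place (not (s xor flip i)) (τ i)      ≡⟨ opposite-place (s xor flip i) (τ i) ⟨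
      opposite (place (s xor flip i) (τ i)) ≡⟨ cong opposite (act-place s i≤m) ⟨
      opposite (act (place s i))            ∎
      where open ≡-Reasoning

    -- `act` commutes with the reversal, so it equals its own conjugate.
    δ-hankel : HankelSymmetric (δ act)
    δ-hankel r c = trans (δ-conjugate act act-involutive r c) (cong (λ x → if does (x Fin.≟ c) then 1ℚ else 0ℚ)
      (trans (cong opposite (act-opposite r)) (Finₚ.opposite-involutive (act r))))

  -- Brings equality of positions into the Boolean form of the block entries. The strict bounds keep
  -- away from the centre, where the sign is not determined.
  place-≟ : ∀ s t {i j} → i < m → j < m → does (place s i Fin.≟ place t j) ≡ (i ≡ᵇ j) ∧ not (s xor t)
  place-≟ s t {i} {j} i<m j<m with i ≟ j | s Boolₚ.≟ t
  ... | yes refl | yes refl = trans (dec-true (place s i Fin.≟ place s i) refl) (sym (cong₂ _∧_ (dec-true (i ≟ i) refl) (cong not (Boolₚ.xor-same s))))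
  ... | yes refl | no s≢t = trans
          (dec-false (place s i Fin.≟ place t i) λ eq → s≢t (proj₂ (place-injective s t (ℕₚ.<⇒≤ i<m) (ℕₚ.<⇒≤ i<m) eq) i<m))
          (sym (trans (cong ((i ≡ᵇ i) ∧_) (cong not (xor-≢ s≢t))) (Boolₚ.∧-zeroʳ (i ≡ᵇ i))))
    where
    xor-≢ : ∀ {s t} → s ≢ t → s xor t ≡ true
    xor-≢ {false} {false} neq = contradiction refl neq
    xor-≢ {false} {true}  neq = refl
    xor-≢ {true}  {false} neq = refl
    xor-≢ {true}  {true}  neq = contradiction refl neq
  ... | no i≢j | _ = trans
          (dec-false (place s i Fin.≟ place t j) λ eq → i≢j (proj₁ (place-injective s t (ℕₚ.<⇒≤ i<m) (ℕₚ.<⇒≤ j<m) eq)))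
          (sym (cong (_∧ not (s xor t)) (dec-false (i ≟ j) i≢j)))

-- Entries of the generators

data SwapView (i j r : ℕ) : ℕ → Set where
  left  : r ≡ i → SwapView i j r j
  right : r ≢ i → r ≡ j → SwapView i j r i
  fixed : r ≢ i → r ≢ j → SwapView i j r r

swapView : ∀ i j r → SwapView i j r (swap i j r)
swapView i j r with r ≟ i
... | yes r≡i rewrite dec-true (r ≟ i) r≡i = left r≡i
... | no  r≢i rewrite dec-false (r ≟ i) r≢i with r ≟ j
...   | yes r≡j rewrite dec-true (r ≟ j) r≡j = right r≢i r≡j
...   | no  r≢j rewrite dec-false (r ≟ j) r≢j = fixed r≢i r≢j

swap-involutive : ∀ i j r → swap i j (swap i j r) ≡ r
swap-involutive i j r with swap i j r | swapView i j r
... | _ | left refl with swap r j j | swapView r j j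
...   | _ | left j≡r    = j≡r
...   | _ | right _ _   = refl
...   | _ | fixed _ j≢j = contradiction refl j≢j
swap-involutive i j r | _ | right r≢i refl with swap i r i | swapView i r i
...   | _ | left _      = refl
...   | _ | right i≢i _ = contradiction refl i≢i
...   | _ | fixed i≢i _ = contradiction refl i≢i
swap-involutive i j r | _ | fixed r≢i r≢j with swap i j r | swapView i j r
...   | _ | left r≡i    = contradiction r≡i r≢i
...   | _ | right _ r≡j = contradiction r≡j r≢j
...   | _ | fixed _ _   = refl

swap-< : ∀ {i j r m} → i < m → j < m → r < m → swap i j r < m
swap-< {i} {j} {r} i<m j<m r<m with swap i j r | swapView i j r
... | _ | left _    = j<m
... | _ | right _ _ = i<m
... | _ | fixed _ _ = r<m

swap-left : ∀ i j → swap i j i ≡ j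
swap-left i j with swap i j i | swapView i j i
... | _ | left _      = refl
... | _ | right i≢i _ = contradiction refl i≢i
... | _ | fixed i≢i _ = contradiction refl i≢i

swap-fixed : ∀ {i j r} → r ≢ i → r ≢ j → swap i j r ≡ r
swap-fixed {i} {j} {r} r≢i r≢j with swap i j r | swapView i j r
... | _ | left r≡i    = contradiction r≡i r≢i
... | _ | right _ r≡j = contradiction r≡j r≢j
... | _ | fixed _ _   = refl

-- Above the diagonal a transposition matrix has a single 1: in the other branches of `swap` the
-- image of i would be smaller than i or equal to it.
swap-determined : ∀ {i j k l} → i < j → k < l → swap k l i ≡ j → (i , j) ≡ (k , l)
swap-determined {i} {j} {k} {l} i<j k<l eq with swap k l i | swapView k l i
swap-determined i<j k<l refl | _ | left refl    = refl
swap-determined i<j k<l refl | _ | right _ refl = contradiction i<j (ℕₚ.<-asym k<l)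
swap-determined i<j k<l refl | _ | fixed _ _    = contradiction i<j (ℕₚ.<-irrefl refl)

complement-involutive : ∀ {m i} → i < m → m ∸ 1 ∸ (m ∸ 1 ∸ i) ≡ i
complement-involutive (s≤s i≤m) = ℕₚ.m∸[m∸n]≡n i≤m

module Generators (m : ℕ) where
  open Positions m public

  -- The form on which `insertMid` and `block` compute: the shift removes the `suc`, and the block
  -- offset removes m.
  toℕ-hi-suc : ∀ {i} → i < m → toℕ (hi i) ≡ suc (m + (m ∸ 1 ∸ i))
  toℕ-hi-suc {i} i<m@(s≤s {n = m-1} i≤m-1) = begin
    toℕ (hi i)                ≡⟨ toℕ-hi (ℕₚ.<⇒≤ i<m) ⟩
    2 * m ∸ i                 ≡⟨ cong (_∸ i) 2m≡m+m ⟩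
    m + m ∸ i                 ≡⟨ ℕₚ.+-∸-assoc m (ℕₚ.<⇒≤ i<m) ⟩
    m + (m ∸ i)               ≡⟨ cong (m +_) (ℕₚ.+-∸-assoc 1 i≤m-1) ⟩
    m + suc (m ∸ 1 ∸ i)       ≡⟨ ℕₚ.+-suc m _ ⟩
    suc (m + (m ∸ 1 ∸ i))     ∎
    where open ≡-Reasoning

  -- Distances are measured from the outer border, so in a mirrored half distance i is index m-1-i
  -- of the block.
  quadrant : RMat → RMat → RMat → RMat → Bool → Bool → RMat
  quadrant P Q R S false false i j = P i j
  quadrant P Q R S false true  i j = Q i (m ∸ 1 ∸ j)
  quadrant P Q R S true  false i j = R (m ∸ 1 ∸ i) j
  quadrant P Q R S true  true  i j = S (m ∸ 1 ∸ i) (m ∸ 1 ∸ j)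

  private
    <ᵇ-irr : ∀ d → (m + d <ᵇ m) ≡ false
    <ᵇ-irr d = dec-false (m + d <? m) (ℕₚ.m+n≮m m d)

    suc<ᵇ : ∀ d → (suc (m + d) <ᵇ m) ≡ false
    suc<ᵇ d = dec-false (suc (m + d) <? m) λ lt → ℕₚ.m+n≮m m (suc d) (subst (_< m) (sym (ℕₚ.+-suc m d)) lt)

    suc≡ᵇ : ∀ d → (suc (m + d) ≡ᵇ m) ≡ false
    suc≡ᵇ d = dec-false (suc (m + d) ≟ m) λ eq → ℕₚ.m+1+n≢m m (trans (ℕₚ.+-suc m d) eq)

  insertMid-quadrant : ∀ P Q R S s t {i j} → i < m → j < m →
    insertMid m (block m P Q R S) (toℕ (place s i)) (toℕ (place t j)) ≡ quadrant P Q R S s t i j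
  insertMid-quadrant P Q R S false false {i} {j} i<m j<m
    rewrite toℕ-lo (ℕₚ.<⇒≤ i<m) | toℕ-lo (ℕₚ.<⇒≤ j<m)
          | dec-false (i ≟ m) (ℕₚ.<⇒≢ i<m) | dec-false (j ≟ m) (ℕₚ.<⇒≢ j<m)
          | dec-true (i <? m) i<m | dec-true (j <? m) j<m
          -- The comparisons with m are decided a second time: the tests of `block` take this form
          -- only after those of the shift have been evaluated.
          | dec-true (i <? m) i<m | dec-true (j <? m) j<m = refl
  insertMid-quadrant P Q R S false true {i} {j} i<m j<m
    rewrite toℕ-lo (ℕₚ.<⇒≤ i<m) | toℕ-hi-suc j<m
          | dec-false (i ≟ m) (ℕₚ.<⇒≢ i<m) | suc≡ᵇ (m ∸ 1 ∸ j)
          | dec-true (i <? m) i<m | suc<ᵇ (m ∸ 1 ∸ j)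
          | dec-true (i <? m) i<m | <ᵇ-irr (m ∸ 1 ∸ j)
          | ℕₚ.m+n∸m≡n m (m ∸ 1 ∸ j) = refl
  insertMid-quadrant P Q R S true false {i} {j} i<m j<m
    rewrite toℕ-hi-suc i<m | toℕ-lo (ℕₚ.<⇒≤ j<m)
          | suc≡ᵇ (m ∸ 1 ∸ i) | dec-false (j ≟ m) (ℕₚ.<⇒≢ j<m)
          | suc<ᵇ (m ∸ 1 ∸ i) | dec-true (j <? m) j<m
          | <ᵇ-irr (m ∸ 1 ∸ i) | dec-true (j <? m) j<m
          | ℕₚ.m+n∸m≡n m (m ∸ 1 ∸ i) = refl
  insertMid-quadrant P Q R S true true {i} {j} i<m j<m
    rewrite toℕ-hi-suc i<m | toℕ-hi-suc j<m
          | suc≡ᵇ (m ∸ 1 ∸ i) | suc≡ᵇ (m ∸ 1 ∸ j)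
          | suc<ᵇ (m ∸ 1 ∸ i) | suc<ᵇ (m ∸ 1 ∸ j)
          | <ᵇ-irr (m ∸ 1 ∸ i) | <ᵇ-irr (m ∸ 1 ∸ j)
          | ℕₚ.m+n∸m≡n m (m ∸ 1 ∸ i) | ℕₚ.m+n∸m≡n m (m ∸ 1 ∸ j) = refl

  toℕ-place-≡ᵇ : ∀ s {i} → i < m → (toℕ (place s i) ≡ᵇ m) ≡ false
  toℕ-place-≡ᵇ false i<m rewrite toℕ-lo (ℕₚ.<⇒≤ i<m) = dec-false (_ ≟ m) (ℕₚ.<⇒≢ i<m)
  toℕ-place-≡ᵇ true {i} i<m rewrite toℕ-hi-suc i<m = suc≡ᵇ (m ∸ 1 ∸ i)

  toℕ-mid-≡ᵇ : ∀ s → (toℕ (place s m) ≡ᵇ m) ≡ true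
  toℕ-mid-≡ᵇ s rewrite place-mid s | toℕ-lo ℕₚ.≤-refl = dec-true (m ≟ m) refl

  place-≢-mid : ∀ s t {i} → i < m → place s i ≢ place t m
  place-≢-mid s t i<m eq = ℕₚ.<⇒≢ i<m (proj₁ (place-injective s t (ℕₚ.<⇒≤ i<m) ℕₚ.≤-refl eq))

  module _ (ρ : Signed) where
    open Signed ρ

    -- The inserted row and column agree with `act` because `τ` fixes m and maps smaller distances
    -- to smaller ones; what remains is a comparison in each quadrant.
    insertMid-act : ∀ P Q R S →
      (∀ s t i j → i < m → j < m → quadrant P Q R S s t i j ≡ (τ i ≡ᵇ j) ∧ not ((s xor flip i) xor t)) →
      toMat (insertMid m (block m P Q R S)) ≈ₘ δ act
    insertMid-act P Q R S match r c with cover r | cover c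
    ... | s , i , i≤m , refl | t , j , j≤m , refl = cong (λ b → if b then 1ℚ else 0ℚ)
      (trans (entry s t i≤m j≤m) (cong (λ x → does (x Fin.≟ place t j)) (sym (act-place s i≤m))))
      where
      entry : ∀ s t {i j} → i ≤ m → j ≤ m →
        insertMid m (block m P Q R S) (toℕ (place s i)) (toℕ (place t j))
          ≡ does (place (s xor flip i) (τ i) Fin.≟ place t j)
      entry s t i≤m j≤m with ℕₚ.m≤n⇒m<n∨m≡n i≤m | ℕₚ.m≤n⇒m<n∨m≡n j≤m
      ... | inj₁ i<m | inj₁ j<m =
        trans (insertMid-quadrant P Q R S s t i<m j<m)
          (trans (match s t _ _ i<m j<m) (sym (place-≟ (s xor flip _) t (τ-< i<m) j<m)))
      ... | inj₁ i<m | inj₂ refl rewrite toℕ-place-≡ᵇ s i<m | toℕ-mid-≡ᵇ t =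
        sym (dec-false (_ Fin.≟ _) (place-≢-mid (s xor flip _) t (τ-< i<m)))
      ... | inj₂ refl | inj₁ j<m rewrite toℕ-mid-≡ᵇ s | toℕ-place-≡ᵇ t j<m | τ-mid =
        sym (dec-false (_ Fin.≟ _) (place-≢-mid t (s xor flip m) j<m ∘ sym))
      ... | inj₂ refl | inj₂ refl rewrite toℕ-mid-≡ᵇ s | toℕ-mid-≡ᵇ t | τ-mid =
        sym (dec-true (_ Fin.≟ _) (trans (place-mid (s xor flip m)) (sym (place-mid t))))

  -- Without reflection this gives T̃; reflecting every position gives H̃.
  swapSigned : ∀ {i j} → i < j → j < m → Bool → Signed
  swapSigned {i} {j} i<j j<m b = record
    { τ      = swap i j
    ; flip   = λ _ → b
    ; τ-<    = swap-< i<m j<m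
    ; τ-mid  = swap-fixed (ℕₚ.>⇒≢ i<m) (ℕₚ.>⇒≢ j<m)
    ; τ-inv  = swap-involutive i j
    ; flip-τ = λ _ → refl
    }
    where i<m = ℕₚ.<-trans i<j j<m

  -- U_k fixes the positions at distance below k and reflects all others.
  diagSigned : ℕ → Signed
  diagSigned k = record
    { τ = λ i → i ; flip = k ≤ᵇ_ ; τ-< = λ i<m → i<m ; τ-mid = refl ; τ-inv = λ _ → refl ; flip-τ = λ _ → refl }

  T̃-act : ∀ {i j} (i<j : i < j) (j<m : j < m) →
    toMat (insertMid m (T̃ m i j)) ≈ₘ δ (Signed.act (swapSigned i<j j<m false))
  T̃-act {i} {j} i<j j<m = insertMid-act (swapSigned i<j j<m false) (Tᵣ m i j) Oᵣ Oᵣ (πᵣ m (Tᵣ m i j)) λ where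
    false false r c _ _ → sym (Boolₚ.∧-identityʳ _)
    false true  r c _ _ → sym (Boolₚ.∧-zeroʳ _)
    true  false r c _ _ → sym (Boolₚ.∧-zeroʳ _)
    true  true  r c r<m c<m → trans
      (cong₂ (Tᵣ m i j) (complement-involutive r<m) (complement-involutive c<m)) (sym (Boolₚ.∧-identityʳ _))

  H̃-act : ∀ {i j} (i<j : i < j) (j<m : j < m) →
    toMat (insertMid m (H̃ m i j)) ≈ₘ δ (Signed.act (swapSigned i<j j<m true))
  H̃-act {i} {j} i<j j<m = insertMid-act (swapSigned i<j j<m true) Oᵣ (Hᵣ m i j) (πᵣ m (Hᵣ m i j)) Oᵣ λ where
    false false r c _ _ → sym (Boolₚ.∧-zeroʳ _)
    false true  r c r<m c<m → trans (cong (Tᵣ m i j r) (complement-involutive c<m)) (sym (Boolₚ.∧-identityʳ _))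
    true  false r c r<m c<m → trans
      (cong₂ (Tᵣ m i j) (complement-involutive r<m) (complement-involutive c<m)) (sym (Boolₚ.∧-identityʳ _))
    true  true  r c _ _ → sym (Boolₚ.∧-zeroʳ _)

  U-act : ∀ k → toMat (insertMid m (Uᵣ m k)) ≈ₘ δ (Signed.act (diagSigned k))
  U-act k = insertMid-act (diagSigned k) (Aᵣ k) (Bᵣ m k) (πᵣ m (Bᵣ m k)) (πᵣ m (Aᵣ k)) match
    where
    swap-true : ∀ b → b xor true ≡ not b xor false
    swap-true false = refl
    swap-true true  = refl
    double-true : ∀ b → b xor false ≡ not b xor true
    double-true false = refl
    double-true true  = refl
    <ᵇ-not : ∀ r → (r <ᵇ k) ≡ not ((k ≤ᵇ r) xor false)
    <ᵇ-not r with k ≤? r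
    ... | yes k≤r rewrite dec-true (k ≤? r) k≤r = dec-false (r <? k) (ℕₚ.≤⇒≯ k≤r)
    ... | no  k≰r rewrite dec-false (k ≤? r) k≰r = dec-true (r <? k) (ℕₚ.≰⇒> k≰r)
    A-match : ∀ r c → Aᵣ k r c ≡ (r ≡ᵇ c) ∧ not ((k ≤ᵇ r) xor false)
    A-match r c = cong ((r ≡ᵇ c) ∧_) (<ᵇ-not r)
    complement-≡ᵇ : ∀ {r c} → r < m → c < m → (m ∸ 1 ∸ c ≡ᵇ m ∸ 1 ∸ r) ≡ (r ≡ᵇ c)
    complement-≡ᵇ {r} {c} r<m c<m with r ≟ c
    ... | yes refl = trans (dec-true (m ∸ 1 ∸ r ≟ m ∸ 1 ∸ r) refl) (sym (dec-true (r ≟ r) refl))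
    ... | no  r≢c  = trans
            (dec-false (m ∸ 1 ∸ c ≟ m ∸ 1 ∸ r) λ eq → r≢c (trans (sym (complement-involutive r<m))
              (trans (cong (m ∸ 1 ∸_) (sym eq)) (complement-involutive c<m))))
            (sym (dec-false (r ≟ c) r≢c))
    B-match : ∀ {r c} → r < m → c < m → Bᵣ m k r (m ∸ 1 ∸ c) ≡ (r ≡ᵇ c) ∧ not ((k ≤ᵇ r) xor true)
    B-match {r} {c} r<m c<m rewrite dec-true (r <? m) r<m | complement-≡ᵇ r<m c<m =
      trans (Boolₚ.∧-comm (k ≤ᵇ r) (r ≡ᵇ c)) (cong ((r ≡ᵇ c) ∧_) (sym (not-xor-true (k ≤ᵇ r))))
      where
      not-xor-true : ∀ b → not (b xor true) ≡ b
      not-xor-true false = refl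
      not-xor-true true  = refl
    match : ∀ s t r c → r < m → c < m →
      quadrant (Aᵣ k) (Bᵣ m k) (πᵣ m (Bᵣ m k)) (πᵣ m (Aᵣ k)) s t r c ≡ (r ≡ᵇ c) ∧ not ((s xor (k ≤ᵇ r)) xor t)
    match false false r c _ _ = A-match r c
    match false true  r c r<m c<m = B-match r<m c<m
    match true  false r c r<m c<m = trans
      (cong (λ x → Bᵣ m k x (m ∸ 1 ∸ c)) (complement-involutive r<m))
      (trans (B-match r<m c<m) (cong (λ b → (r ≡ᵇ c) ∧ not b) (swap-true (k ≤ᵇ r))))
    match true  true  r c r<m c<m = trans
      (cong₂ (Aᵣ k) (complement-involutive r<m) (complement-involutive c<m))
      (trans (A-match r c) (cong (λ b → (r ≡ᵇ c) ∧ not b) (double-true (k ≤ᵇ r))))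

-- Balanced matrices

transpose-comm : ∀ {k} (i j x : Fin k) → transpose i j x ≡ transpose j i x
transpose-comm i j x with x Fin.≟ i | x Fin.≟ j
... | yes refl | yes refl = refl
... | yes x≡i  | no _     rewrite dec-true (x Fin.≟ i) x≡i = refl
... | no _     | yes x≡j  rewrite dec-true (x Fin.≟ j) x≡j = refl
... | no x≢i   | no x≢j   rewrite dec-false (x Fin.≟ i) x≢i | dec-false (x Fin.≟ j) x≢j = refl

transpose-involutive : ∀ {k} (i j x : Fin k) → transpose i j (transpose i j x) ≡ x
transpose-involutive i j x = trans (cong (transpose i j) (transpose-comm i j x)) (transpose-inverse i j)

transpose-left : ∀ {k} (i j : Fin k) → transpose i j i ≡ j
transpose-left i j rewrite dec-true (i Fin.≟ i) refl = refl

transpose-fixed : ∀ {k} {i j x : Fin k} → x ≢ i → x ≢ j → transpose i j x ≡ x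
transpose-fixed {i = i} {j} {x} x≢i x≢j rewrite dec-false (x Fin.≟ i) x≢i | dec-false (x Fin.≟ j) x≢j = refl

-- The common row sum is left free, which makes this a linear space containing the polytope.
Balanced : ∀ {k} → Mat k → Set
Balanced X = Symmetric X × HankelSymmetric X × Σ ℚ λ s → ∀ r → sumFin (X r) ≡ s

-- `add` has the shape of one elimination step; `respects` is there because matrices are compared
-- entrywise.
record IsSubspace {k} (W : Mat k → Set) : Set where
  field
    respects : ∀ {X Y} → X ≈ₘ Y → W X → W Y
    zeroMat  : W Oₘ
    add      : ∀ {X Y} b → W Y → W X → W (X +ₘ (b ·ₘ Y))

  span⊆ : ∀ {S : Mat k → Set} → (∀ X → S X → W X) → ∀ {X} → InSpan S X → W X
  span⊆ {S} S⊆W (p , v , Sv , a , eq) = respects eq (sums p v Sv a)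
    where
    sums : ∀ p (v : Fin p → Mat k) → (∀ i → S (v i)) → ∀ (a : Fin p → ℚ) → W (sumMat (λ i → a i ·ₘ v i))
    sums zero    v Sv a = zeroMat
    sums (suc p) v Sv a = respects (λ r c → ℚₚ.+-comm _ (a zero ℚ.* v zero r c))
      (add (a zero) (S⊆W _ (Sv zero)) (sums p (v ∘ suc) (Sv ∘ suc) (a ∘ suc)))

balanced-subspace : ∀ {k} → IsSubspace (Balanced {k})
balanced-subspace = record
  { respects = λ eq (symX , hankX , s , rowX) →
      (λ r c → trans (sym (eq c r)) (trans (symX r c) (eq r c))) ,
      (λ r c → trans (sym (eq _ _)) (trans (hankX r c) (eq r c))) ,
      s , λ r → trans (sumFin-cong λ c → sym (eq r c)) (rowX r)
  ; zeroMat = (λ _ _ → refl) , (λ _ _ → refl) , 0ℚ , λ r → sumFin-zero {f = Oₘ r} (λ _ → refl)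
  ; add = λ {X} {Y} b (symY , hankY , t , rowY) (symX , hankX , s , rowX) →
      (λ r c → cong₂ (λ x y → x ℚ.+ b ℚ.* y) (symX r c) (symY r c)) ,
      (λ r c → cong₂ (λ x y → x ℚ.+ b ℚ.* y) (hankX r c) (hankY r c)) ,
      s ℚ.+ b ℚ.* t , λ r → trans (sumFin-+ (X r) (λ c → b ℚ.* Y r c))
        (cong₂ ℚ._+_ (rowX r) (trans (sumFin-*ˡ b (Y r)) (cong (b ℚ.*_) (rowY r))))
  }

symmetric-stochastic : ∀ {k} {X : Mat k} → Symmetric X → (∀ r c → 0ℚ ℚ.≤ X r c) →
  (∀ r → sumFin (X r) ≡ 1ℚ) → DoublyStochastic X
symmetric-stochastic symX nonneg rows = nonneg , rows , λ c → trans (sumFin-cong λ r → symX c r) (rows c)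

Ωth⇒balanced : ∀ {k} {X : Mat k} → Ωth k X → Balanced X
Ωth⇒balanced ((_ , rows , _) , symX , hankX) = symX , hankX , 1ℚ , rows

Ωth-respects : ∀ {k} {X Y : Mat k} → X ≈ₘ Y → Ωth k X → Ωth k Y
Ωth-respects eq ((nonneg , rows , _) , symX , hankX) =
  symmetric-stochastic symY (λ r c → subst (0ℚ ℚ.≤_) (eq r c) (nonneg r c))
    (λ r → trans (sumFin-cong λ c → sym (eq r c)) (rows r)) ,
  symY , proj₁ (proj₂ (IsSubspace.respects balanced-subspace eq (symX , hankX , 1ℚ , rows)))
  where symY = λ r c → trans (sym (eq c r)) (trans (symX r c) (eq r c))

-- The two reflections compose to the half turn.
centrosymmetric : ∀ {k} {X : Mat k} → Symmetric X → HankelSymmetric X →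
  ∀ r c → X (opposite r) (opposite c) ≡ X r c
centrosymmetric symX hankX r c = trans (sym (symX (opposite r) (opposite c))) (hankX r c)

-- For an involution `f` the second summand is the Hankel transpose of the first, so the average is
-- Hankel-symmetric even when `δ f` is not.
hankelAverage : ∀ {k} → (Fin k → Fin k) → Mat k
hankelAverage f r c = ½ ℚ.* (δ f r c ℚ.+ δ (conjugate f) r c)

hankelAverage-Ωth : ∀ {k} (f : Fin k → Fin k) → (∀ x → f (f x) ≡ x) → Ωth k (hankelAverage f)
hankelAverage-Ωth f inv = symmetric-stochastic symX nonneg rows , symX , hankX
  where
  f′ = conjugate f
  symX : Symmetric (hankelAverage f)
  symX r c = cong₂ (λ x y → ½ ℚ.* (x ℚ.+ y)) (δ-symmetric f inv r c)
    (δ-symmetric f′ (conjugate-involutive f inv) r c)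
  nonneg : ∀ r c → 0ℚ ℚ.≤ hankelAverage f r c
  nonneg r c = ℚₚ.*-monoˡ-≤-nonNeg ½ (ℚₚ.+-mono-≤ (δ-nonneg f r c) (δ-nonneg f′ r c))
  rows : ∀ r → sumFin (hankelAverage f r) ≡ 1ℚ
  rows r = trans (sumFin-*ˡ ½ (λ c → δ f r c ℚ.+ δ f′ r c))
    (cong (½ ℚ.*_) (trans (sumFin-+ (δ f r) (δ f′ r)) (cong₂ ℚ._+_ (δ-rowSum f r) (δ-rowSum f′ r))))
  hankX : HankelSymmetric (hankelAverage f)
  hankX r c = cong (½ ℚ.*_) (trans
    (cong₂ ℚ._+_ (δ-conjugate f inv r c)
      (trans (sym (δ-conjugate f inv (opposite c) (opposite r)))
             (cong₂ (δ f) (Finₚ.opposite-involutive r) (Finₚ.opposite-involutive c))))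
    (ℚₚ.+-comm (δ f′ r c) (δ f r c)))

-- Lists of index pairs

allPairs-refine : ∀ {A : Set} {P : A → Set} {R S : A → A → Set} {xs} →
  (∀ {x y} → P x → P y → R x y → S x y) → All P xs → AllPairs R xs → AllPairs S xs
allPairs-refine f []       []       = []
allPairs-refine f (p ∷ ps) (r ∷ rs) = All.zipWith (λ (q , r) → f p q r) (ps , r) ∷ allPairs-refine f ps rs

pairs-bounded : ∀ m → All (λ (i , j) → i < j × j < m) (pairs m)
pairs-bounded m = Allₚ.concat⁺ (Allₚ.map⁺ (Allₚ.applyUpTo⁺₁ id m λ {j} j<m →
  Allₚ.map⁺ (Allₚ.applyUpTo⁺₁ id j λ i<j → i<j , j<m)))

-- Within one sublist the first components differ; between two sublists the second components do.
pairs-distinct : ∀ m → AllPairs _≢_ (pairs m)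
pairs-distinct m = AllPairsₚ.concat⁺
  (Allₚ.map⁺ (Allₚ.applyUpTo⁺₁ id m λ {j} _ →
    AllPairsₚ.map⁺ (AllPairsₚ.applyUpTo⁺₁ id j λ i<i′ _ eq → ℕₚ.<⇒≢ i<i′ (cong proj₁ eq))))
  (AllPairsₚ.map⁺ (AllPairsₚ.applyUpTo⁺₁ id m λ {j} {j′} j<j′ _ →
    Allₚ.map⁺ (Allₚ.applyUpTo⁺₂ id j λ _ → Allₚ.map⁺ (Allₚ.applyUpTo⁺₂ id j′ λ _ eq → ℕₚ.<⇒≢ j<j′ (cong proj₂ eq)))))

∈-pairs : ∀ {m i j} → i < j → j < m → (i , j) ∈ pairs m
∈-pairs i<j j<m = ∈ₚ.∈-concat⁺′ (∈ₚ.∈-map⁺ _ (∈ₚ.∈-upTo⁺ i<j)) (∈ₚ.∈-map⁺ _ (∈ₚ.∈-upTo⁺ j<m))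

-- mid r is the average adjoined for row r in order to reach the linear hull of Ω; tr and hk are the
-- pairs of T̃ and H̃, and un k is U_k.
data Index : Set where
  mid   : ℕ → Index
  tr hk : ℕ × ℕ → Index
  un    : ℕ → Index

-- The indexed family and its pivots

module Main (m : ℕ) where
  open Generators m

  matrix : Index → Mat N
  matrix (mid r)      = hankelAverage (transpose (lo r) (lo m))
  matrix (tr (i , j)) = toMat (insertMid m (T̃ m i j))
  matrix (hk (i , j)) = toMat (insertMid m (H̃ m i j))
  matrix (un k)       = toMat (insertMid m (Uᵣ m k))

  row col : Index → Fin N
  row (mid r)      = lo r
  row (tr (i , j)) = lo i
  row (hk (i , j)) = lo i
  row (un k)       = lo k
  col (mid r)      = lo m
  col (tr (i , j)) = lo j
  col (hk (i , j)) = hi j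
  col (un k)       = hi k

  open Elimination matrix row col

  trs hks uns mids perms : List Index
  trs   = map tr (pairs m)
  hks   = map hk (pairs m)
  uns   = map un (upTo (suc m))
  mids  = map mid (upTo m)
  perms = trs ++ hks ++ uns

  𝓑*≡perms : 𝓑* m ≡ map matrix perms
  𝓑*≡perms = begin
    map gen (Ts ++ Hs ++ Us)
      ≡⟨ Listₚ.map-++ gen Ts (Hs ++ Us) ⟩
    map gen Ts ++ map gen (Hs ++ Us)
      ≡⟨ cong (map gen Ts ++_) (Listₚ.map-++ gen Hs Us) ⟩
    map gen Ts ++ map gen Hs ++ map gen Us
      ≡⟨ cong₂ _++_ (fuse tr (λ _ → refl) (pairs m))
           (cong₂ _++_ (fuse hk (λ _ → refl) (pairs m)) (fuse un (λ _ → refl) (upTo (suc m)))) ⟩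
    map matrix trs ++ map matrix hks ++ map matrix uns
      ≡⟨ cong (map matrix trs ++_) (Listₚ.map-++ matrix hks uns) ⟨
    map matrix trs ++ map matrix (hks ++ uns)
      ≡⟨ Listₚ.map-++ matrix trs (hks ++ uns) ⟨
    map matrix perms ∎
    where
    open ≡-Reasoning
    gen : RMat → Mat N
    gen X = toMat (insertMid m X)
    Ts = map (λ (i , j) → T̃ m i j) (pairs m)
    Hs = map (λ (i , j) → H̃ m i j) (pairs m)
    Us = map (Uᵣ m) (upTo (suc m))
    fuse : ∀ {A : Set} {f : A → RMat} (c : A → Index) → (∀ x → gen (f x) ≡ matrix (c x)) →
      ∀ xs → map gen (map f xs) ≡ map matrix (map c xs)
    fuse c eq xs = trans (sym (Listₚ.map-∘ xs)) (trans (Listₚ.map-cong eq xs) (Listₚ.map-∘ xs))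

  data Valid : Index → Set where
    mid : ∀ {r} → r < m → Valid (mid r)
    tr  : ∀ {i j} → i < j → j < m → Valid (tr (i , j))
    hk  : ∀ {i j} → i < j → j < m → Valid (hk (i , j))
    un  : ∀ {k} → k ≤ m → Valid (un k)

  -- The common form of T̃, H̃ and U, from which membership in both spaces follows at once for all
  -- three.
  data IsReflection (X : Mat N) : Set where
    reflection : (ρ : Signed) → X ≈ₘ δ (Signed.act ρ) → IsReflection X

  perms-reflection : All (IsReflection ∘ matrix) perms
  perms-reflection = Allₚ.++⁺ (Allₚ.map⁺ (All.map (λ (i<j , j<m) → reflection (swapSigned i<j j<m false) (T̃-act i<j j<m)) (pairs-bounded m)))
    (Allₚ.++⁺ (Allₚ.map⁺ (All.map (λ (i<j , j<m) → reflection (swapSigned i<j j<m true) (H̃-act i<j j<m)) (pairs-bounded m)))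
              (Allₚ.map⁺ (Allₚ.applyUpTo⁺₂ id (suc m) λ k → reflection (diagSigned k) (U-act k))))

  reflection-SymHankPerm : ∀ {X} → IsReflection X → SymHankPerm X
  reflection-SymHankPerm (reflection ρ eq) = σ ,
    (λ r c → trans (permMat≈δ σ r c) (sym (eq r c))) ,
    (λ r c → trans (eq c r) (trans (δ-symmetric act act-involutive r c) (sym (eq r c)))) ,
    (λ r c → trans (eq _ _) (trans (δ-hankel r c) (sym (eq r c))))
    where
    open Signed ρ
    σ : Permutation′ N
    σ = permutation act act act-involutive act-involutive

  reflection-Ωth : ∀ {X} → IsReflection X → Ωth N X
  reflection-Ωth (reflection ρ eq) = Ωth-respects (λ r c → sym (eq r c))
    (symmetric-stochastic symρ (δ-nonneg act) (δ-rowSum act) , symρ , δ-hankel)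
    where
    open Signed ρ
    symρ = δ-symmetric act act-involutive

  reflection-zero : ∀ X (ρ : Signed) → X ≈ₘ δ (Signed.act ρ) → ∀ t i j → i ≤ m →
    place (Signed.flip ρ i) (Signed.τ ρ i) ≢ place t j → X (lo i) (place t j) ≡ 0ℚ
  reflection-zero X ρ eq t i j i≤m neq = trans (eq (lo i) (place t j))
    (δ-zero act {lo i} {place t j} (neq ∘ trans (sym (act-place false i≤m))))
    where open Signed ρ

  reflection-one : ∀ X (ρ : Signed) → X ≈ₘ δ (Signed.act ρ) → ∀ t i j → i ≤ m →
    place (Signed.flip ρ i) (Signed.τ ρ i) ≡ place t j → X (lo i) (place t j) ≢ 0ℚ
  reflection-one X ρ eq t i j i≤m eq′ X≡0 = 1≢0 (trans (sym (trans (eq (lo i) (place t j))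
      (δ-one act {lo i} {place t j} (trans (act-place false i≤m) eq′)))) X≡0)
    where
    open Signed ρ
    1≢0 : 1ℚ ≢ 0ℚ
    1≢0 ()

  -- `act` moves no other position to the centre, so these matrices vanish at the pivots of the
  -- averages.
  reflection-mid : ∀ {X} r → IsReflection X → r < m → X (lo r) (lo m) ≡ 0ℚ
  reflection-mid {X} r (reflection ρ eq) r<m =
    reflection-zero X ρ eq false r m (ℕₚ.<⇒≤ r<m) (place-≢-mid (flip r) false (τ-< r<m))
    where open Signed ρ

  hi≢lo : ∀ {i j} → i < m → j ≤ m → hi i ≢ lo j
  hi≢lo i<m j≤m eq with () ← proj₂ (place-injective true false (ℕₚ.<⇒≤ i<m) j≤m eq) i<m

  lo≢centre : ∀ {i} → i < m → lo i ≢ lo m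
  lo≢centre = place-≢-mid false false

  Clears : Index → Index → Set
  Clears x y = matrix y (row x) (col x) ≡ 0ℚ

  -- The transposition moves no position strictly beyond the centre, so its conjugate moves none
  -- strictly before it. At the pivots of the averages only the unconjugated summand can therefore
  -- contribute.
  conjugate-transpose-fixed : ∀ {r} → r < m → ∀ s → s ≤ m →
    conjugate (transpose (lo s) (lo m)) (lo r) ≡ lo r
  conjugate-transpose-fixed {r} r<m s s≤m = trans
    (cong opposite (transpose-fixed (hi≢lo r<m s≤m) (hi≢lo r<m ℕₚ.≤-refl)))
    (Finₚ.opposite-involutive (lo r))

  conjugate-zero : ∀ {r} → r < m → ∀ s → s ≤ m → δ (conjugate (transpose (lo s) (lo m))) (lo r) (lo m) ≡ 0ℚ
  conjugate-zero {r} r<m s s≤m = δ-zero (conjugate (transpose (lo s) (lo m))) {lo r} {lo m}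
    λ eq → lo≢centre r<m (trans (sym (conjugate-transpose-fixed r<m s s≤m)) eq)

  mid-half : ∀ {r} → r < m → matrix (mid r) (lo r) (lo m) ≡ ½
  mid-half {r} r<m = cong (½ ℚ.*_) (cong₂ ℚ._+_
    (δ-one (transpose (lo r) (lo m)) {lo r} {lo m} (transpose-left (lo r) (lo m)))
    (conjugate-zero r<m r (ℕₚ.<⇒≤ r<m)))

  pivot : ∀ {x} → Valid x → matrix x (row x) (col x) ≢ 0ℚ
  pivot (mid {r} r<m) eq = ½≢0 (trans (sym (mid-half r<m)) eq)
    where
    ½≢0 : ½ ≢ 0ℚ
    ½≢0 ()
  pivot (tr {i} {j} i<j j<m) = reflection-one (matrix (tr (i , j))) (swapSigned i<j j<m false) (T̃-act i<j j<m)
    false i j (ℕₚ.<⇒≤ (ℕₚ.<-trans i<j j<m)) (cong lo (swap-left i j))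
  pivot (hk {i} {j} i<j j<m) = reflection-one (matrix (hk (i , j))) (swapSigned i<j j<m true) (H̃-act i<j j<m)
    true i j (ℕₚ.<⇒≤ (ℕₚ.<-trans i<j j<m)) (cong hi (swap-left i j))
  -- Distance k is the first one reflected by U_k. For k = m the pivot is the centre.
  pivot (un {k} k≤m) = reflection-one (matrix (un k)) (diagSigned k) (U-act k)
    true k k k≤m (cong (λ b → place b k) (dec-true (k ≤? k) ℕₚ.≤-refl))

  mid-mid : ∀ {r s} → r < m → s < m → r ≢ s → Clears (mid r) (mid s)
  mid-mid {r} {s} r<m s<m r≢s = cong (½ ℚ.*_) (cong₂ ℚ._+_
    (δ-zero (transpose (lo s) (lo m)) {lo r} {lo m}
      (lo≢centre r<m ∘ trans (sym (transpose-fixed lo-r≢lo-s (lo≢centre r<m)))))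
    (conjugate-zero r<m s (ℕₚ.<⇒≤ s<m)))
    where
    lo-r≢lo-s : lo r ≢ lo s
    lo-r≢lo-s = r≢s ∘ lo-injective (ℕₚ.<⇒≤ r<m) (ℕₚ.<⇒≤ s<m)

  tr-tr : ∀ {i j k l} → i < j → j < m → k < l → l < m → (i , j) ≢ (k , l) → Clears (tr (i , j)) (tr (k , l))
  tr-tr {i} {j} {k} {l} i<j j<m k<l l<m neq =
    reflection-zero (matrix (tr (k , l))) (swapSigned k<l l<m false) (T̃-act k<l l<m) false i j (ℕₚ.<⇒≤ i<m)
      λ eq → neq (swap-determined i<j k<l
        (lo-injective (ℕₚ.<⇒≤ (swap-< (ℕₚ.<-trans k<l l<m) l<m i<m)) (ℕₚ.<⇒≤ j<m) eq))
    where i<m = ℕₚ.<-trans i<j j<m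

  hk-hk : ∀ {i j k l} → i < j → j < m → k < l → l < m → (i , j) ≢ (k , l) → Clears (hk (i , j)) (hk (k , l))
  hk-hk {i} {j} {k} {l} i<j j<m k<l l<m neq =
    reflection-zero (matrix (hk (k , l))) (swapSigned k<l l<m true) (H̃-act k<l l<m) true i j (ℕₚ.<⇒≤ i<m)
      λ eq → neq (swap-determined i<j k<l
        (lo-injective (ℕₚ.<⇒≤ (swap-< (ℕₚ.<-trans k<l l<m) l<m i<m)) (ℕₚ.<⇒≤ j<m) (opposite-injective eq)))
    where i<m = ℕₚ.<-trans i<j j<m

  -- H̃ sends the first half to the mirrored half, hence vanishes on the upper left block.
  tr-hk : ∀ {i j k l} → i < j → j < m → k < l → l < m → Clears (tr (i , j)) (hk (k , l))
  tr-hk {i} {j} {k} {l} i<j j<m k<l l<m =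
    reflection-zero (matrix (hk (k , l))) (swapSigned k<l l<m true) (H̃-act k<l l<m) false i j (ℕₚ.<⇒≤ i<m)
      (hi≢lo (swap-< (ℕₚ.<-trans k<l l<m) l<m i<m) (ℕₚ.<⇒≤ j<m))
    where i<m = ℕₚ.<-trans i<j j<m

  -- U_k is supported on the two diagonals; both kinds of pair pivots, chosen by `t`, lie off them.
  offDiagonal-un : ∀ t {i j} k → i < j → j < m → matrix (un k) (lo i) (place t j) ≡ 0ℚ
  offDiagonal-un t {i} {j} k i<j j<m =
    reflection-zero (matrix (un k)) (diagSigned k) (U-act k) t i j (ℕₚ.<⇒≤ i<m)
      λ eq → ℕₚ.<⇒≢ i<j (proj₁ (place-injective (k ≤ᵇ i) t (ℕₚ.<⇒≤ i<m) (ℕₚ.<⇒≤ j<m) eq))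
    where i<m = ℕₚ.<-trans i<j j<m

  -- For k < l the matrix U_l still has its 1 of row k on the main diagonal. This fixes the
  -- increasing order of the U's.
  un-un : ∀ {k l} → k < l → l < suc m → Clears (un k) (un l)
  un-un {k} {l} k<l (s≤s l≤m) = reflection-zero (matrix (un l)) (diagSigned l) (U-act l) true k k (ℕₚ.<⇒≤ k<m) neq
    where
    k<m = ℕₚ.<-≤-trans k<l l≤m
    neq : place (l ≤ᵇ k) k ≢ hi k
    neq rewrite dec-false (l ≤? k) (ℕₚ.<⇒≱ k<l) = hi≢lo k<m (ℕₚ.<⇒≤ k<m) ∘ sym

  perms-valid : All Valid perms
  perms-valid = Allₚ.++⁺ (Allₚ.map⁺ (All.map (uncurry tr) (pairs-bounded m)))
    (Allₚ.++⁺ (Allₚ.map⁺ (All.map (uncurry hk) (pairs-bounded m)))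
              (Allₚ.map⁺ (Allₚ.applyUpTo⁺₁ id (suc m) λ { (s≤s k≤m) → un k≤m })))

  perms-echelon : Echelon perms
  perms-echelon = All.map pivot perms-valid , AllPairsₚ.++⁺ trs-clear
    (AllPairsₚ.++⁺ hks-clear uns-clear (Allₚ.map⁺ (All.map (λ (i<j , j<m) →
      Allₚ.map⁺ (Allₚ.applyUpTo⁺₂ id (suc m) λ k → offDiagonal-un true k i<j j<m)) (pairs-bounded m))))
    (Allₚ.map⁺ (All.map (λ (i<j , j<m) → Allₚ.++⁺
      (Allₚ.map⁺ (All.map (λ (k<l , l<m) → tr-hk i<j j<m k<l l<m) (pairs-bounded m)))
      (Allₚ.map⁺ (Allₚ.applyUpTo⁺₂ id (suc m) λ k → offDiagonal-un false k i<j j<m))) (pairs-bounded m)))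
    where
    trs-clear : AllPairs Clears trs
    trs-clear = AllPairsₚ.map⁺ (allPairs-refine
      (λ (i<j , j<m) (k<l , l<m) → tr-tr i<j j<m k<l l<m) (pairs-bounded m) (pairs-distinct m))
    hks-clear : AllPairs Clears hks
    hks-clear = AllPairsₚ.map⁺ (allPairs-refine
      (λ (i<j , j<m) (k<l , l<m) → hk-hk i<j j<m k<l l<m) (pairs-bounded m) (pairs-distinct m))
    uns-clear : AllPairs Clears uns
    uns-clear = AllPairsₚ.map⁺ (AllPairsₚ.applyUpTo⁺₁ id (suc m) un-un)

  -- The averages come first because the other matrices vanish in the middle column off the centre.
  all-echelon : Echelon (mids ++ perms)
  all-echelon = Allₚ.++⁺ (Allₚ.map⁺ (Allₚ.applyUpTo⁺₁ id m (pivot ∘ mid))) (proj₁ perms-echelon) ,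
    AllPairsₚ.++⁺
      (AllPairsₚ.map⁺ (AllPairsₚ.applyUpTo⁺₁ id m λ r<s s<m → mid-mid (ℕₚ.<-trans r<s s<m) s<m (ℕₚ.<⇒≢ r<s)))
      (proj₂ perms-echelon)
      (Allₚ.map⁺ (Allₚ.applyUpTo⁺₁ id m λ r<m → All.map (λ y → reflection-mid _ y r<m) perms-reflection))

  -- Vanishing of the remainder

  vanish : ∀ {X : Mat N} → Balanced X →
    (∀ {r} → r < m → X (lo r) (lo m) ≡ 0ℚ) → All (λ x → X (row x) (col x) ≡ 0ℚ) perms → X ≈ₘ Oₘ
  vanish {X} (symX , hankX , s , rowSum) mid≡0 perms≡0 = entry
    where
    flipped : ∀ r c → X (opposite r) (opposite c) ≡ X r c
    flipped = centrosymmetric symX hankX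
    antidiagonal : ∀ {k} → k ≤ m → X (lo k) (hi k) ≡ 0ℚ
    antidiagonal k≤m = All.lookup perms≡0 (∈ₚ.∈-++⁺ʳ trs (∈ₚ.∈-++⁺ʳ hks (∈ₚ.∈-map⁺ un (∈ₚ.∈-upTo⁺ (s≤s k≤m)))))
    upper : ∀ t {i j} → i < j → j ≤ m → X (lo i) (place t j) ≡ 0ℚ
    upper t i<j j≤m with ℕₚ.m≤n⇒m<n∨m≡n j≤m
    -- The middle column is a separate hypothesis: for the span of permutation matrices it comes
    -- from `Centred`, for the polytope from the pivots of `mids`.
    upper t     i<j _ | inj₂ refl rewrite place-mid t = mid≡0 i<j
    upper false i<j _ | inj₁ j<m = All.lookup perms≡0 (∈ₚ.∈-++⁺ˡ (∈ₚ.∈-map⁺ tr (∈-pairs i<j j<m)))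
    upper true  i<j _ | inj₁ j<m = All.lookup perms≡0 (∈ₚ.∈-++⁺ʳ trs (∈ₚ.∈-++⁺ˡ (∈ₚ.∈-map⁺ hk (∈-pairs i<j j<m))))
    lower : ∀ t {i j} → j < i → i ≤ m → X (lo i) (place t j) ≡ 0ℚ
    lower false j<i i≤m = trans (symX _ _) (upper false j<i i≤m)
    -- Transposition followed by the half turn reflects the entry across the antidiagonal into the
    -- range of `upper`.
    lower true {i} {j} j<i i≤m = begin
      X (lo i) (hi j)            ≡⟨ symX (lo i) (hi j) ⟨
      X (hi j) (lo i)            ≡⟨ flipped (hi j) (lo i) ⟨
      X (opposite (hi j)) (hi i) ≡⟨ cong (λ x → X x (hi i)) (opposite-place true j) ⟩
      X (lo j) (hi i)            ≡⟨ upper true j<i i≤m ⟩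
      0ℚ                         ∎
      where open ≡-Reasoning
    off : ∀ {i} → i ≤ m → ∀ c → c ≢ lo i → X (lo i) c ≡ 0ℚ
    off {i} i≤m c c≢ with cover c
    ... | t , j , j≤m , refl with ℕₚ.<-cmp i j
    off i≤m c c≢ | t     , j , j≤m , refl | tri< i<j _ _  = upper t i<j j≤m
    off i≤m c c≢ | t     , j , j≤m , refl | tri> _ _ j<i  = lower t j<i i≤m
    off i≤m c c≢ | true  , j , j≤m , refl | tri≈ _ refl _ = antidiagonal j≤m
    off i≤m c c≢ | false , j , j≤m , refl | tri≈ _ refl _ = contradiction refl c≢
    centre : X (lo m) (lo m) ≡ 0ℚ
    centre = trans (cong (X (lo m)) (sym (place-mid true))) (antidiagonal ℕₚ.≤-refl)
    -- Each row sum has shrunk to its diagonal entry. The one of the middle row is the centre, an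
    -- antidiagonal entry and hence 0.
    diagonal : ∀ {i} → i ≤ m → X (lo i) (lo i) ≡ 0ℚ
    diagonal {i} i≤m = begin
      X (lo i) (lo i) ≡⟨ sumFin-single (lo i) (off i≤m) ⟨
      sumFin (X (lo i)) ≡⟨ rowSum (lo i) ⟩
      s                 ≡⟨ rowSum (lo m) ⟨
      sumFin (X (lo m)) ≡⟨ sumFin-single (lo m) (off ℕₚ.≤-refl) ⟩
      X (lo m) (lo m)   ≡⟨ centre ⟩
      0ℚ                ∎
      where open ≡-Reasoning
    near : ∀ {i} → i ≤ m → ∀ c → X (lo i) c ≡ 0ℚ
    near {i} i≤m c with c Fin.≟ lo i
    ... | yes refl = diagonal i≤m
    ... | no  c≢   = off i≤m c c≢
    entry : X ≈ₘ Oₘ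
    entry r c with cover r
    ... | false , i , i≤m , refl = near i≤m c
    -- The half turn carries the second half of the rows to the first.
    ... | true  , i , i≤m , refl = trans (cong (X (hi i)) (sym (Finₚ.opposite-involutive c)))
      (trans (flipped (lo i) (opposite c)) (near i≤m (opposite c)))

  -- Basis of the span and dimension of the polytope

  Centred : Mat N → Set
  Centred X = Balanced X × (∀ {r} → r < m → X (lo r) (lo m) ≡ 0ℚ)

  centred-subspace : IsSubspace Centred
  centred-subspace = record
    { respects = λ eq (bal , mid≡0) → respects eq bal , λ r<m → trans (sym (eq _ _)) (mid≡0 r<m)
    ; zeroMat  = zeroMat , λ _ → refl
    ; add      = λ {X} {Y} b (balY , midY) (balX , midX) → add b balY balX , λ r<m →
        cong₂ ℚ._+_ (midX r<m) (trans (cong (b ℚ.*_) (midY r<m)) (ℚₚ.*-zeroʳ b))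
    }
    where open IsSubspace balanced-subspace

  -- By the half turn, a 1 of the middle column in row `lo r` is repeated in row `hi r`; the
  -- permutation would then send two positions to the centre.
  SymHankPerm⇒centred : ∀ X → SymHankPerm X → Centred X
  SymHankPerm⇒centred X (σ , same , symX , hankX) = (symX , hankX , 1ℚ , rows) , mid≡0
    where
    entry : X ≈ₘ δ (σ ⟨$⟩ʳ_)
    entry r c = trans (sym (same r c)) (permMat≈δ σ r c)
    rows : ∀ r → sumFin (X r) ≡ 1ℚ
    rows r = trans (sumFin-cong (entry r)) (δ-rowSum (σ ⟨$⟩ʳ_) r)
    mid≡0 : ∀ {r} → r < m → X (lo r) (lo m) ≡ 0ℚ
    mid≡0 {r} r<m with X (lo r) (lo m) ℚ.≟ 0ℚ
    ... | yes ≡0 = ≡0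
    ... | no  ≢0 = contradiction
            (trans (sym (inverseˡ σ)) (trans (cong (σ ⟨$⟩ˡ_) (trans (σ-lo (hi r) ≢0′) (sym (σ-lo (lo r) ≢0)))) (inverseˡ σ)))
            (hi≢lo r<m (ℕₚ.<⇒≤ r<m))
      where
      σ-lo : ∀ x → X x (lo m) ≢ 0ℚ → σ ⟨$⟩ʳ x ≡ lo m
      σ-lo x neq = δ-nonzero (σ ⟨$⟩ʳ_) {x} {lo m} (neq ∘ trans (entry x (lo m)))
      ≢0′ : X (hi r) (lo m) ≢ 0ℚ
      ≢0′ = ≢0 ∘ trans (trans (sym (centrosymmetric symX hankX (lo r) (lo m))) (cong (X (hi r)) (place-mid true)))

  basis : IsBasisOfSpan (map matrix perms) SymHankPerm
  basis = inSpan , spans , echelon⇒independent perms perms-echelon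
    where
    L = map matrix perms
    members : All SymHankPerm L
    members = Allₚ.map⁺ (All.map (λ {x} → reflection-SymHankPerm {matrix x}) perms-reflection)
    inSpan : ∀ i → InSpan SymHankPerm (lookup L i)
    inSpan i = 1 , (λ _ → lookup L i) , (λ _ → All.lookup members (∈ₚ.∈-lookup i)) ,
      (λ _ → 1ℚ) , λ r c → trans (ℚₚ.+-identityʳ (1ℚ ℚ.* lookup L i r c)) (ℚₚ.*-identityˡ (lookup L i r c))
    centred : All (Centred ∘ matrix) perms
    centred = All.map (λ {x} y → SymHankPerm⇒centred (matrix x) (reflection-SymHankPerm y)) perms-reflection
    spans : ∀ X → InSpan SymHankPerm X → Σ (Fin (length L) → ℚ) λ a → combo L a ≈ₘ X
    spans X X∈ = echelon⇒spans Centred (Centred ∘ matrix)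
      (λ {X} {x} b → IsSubspace.add centred-subspace {X} {matrix x} b) perms perms-echelon centred
      (λ R (balR , midR) → vanish {R} balR midR) X
      (IsSubspace.span⊆ centred-subspace {SymHankPerm} SymHankPerm⇒centred {X} X∈)

  -- The averages and the permutation matrices are points of the polytope, independent by
  -- `all-echelon`, and span every balanced matrix. Taking the size as an equation with `suc d`
  -- avoids truncated subtraction.
  dimension : ∀ {d} → m + length (map matrix perms) ≡ suc d → HasAffineDim (Ωth N) d
  dimension size = affineDim (lookup family) (trans family-size size)
    (λ i → All.lookup members (∈ₚ.∈-lookup i))
    (echelon⇒independent (mids ++ perms) all-echelon) spans (λ X ((_ , rows , _) , _) → rows zero)
    where
    family = map matrix (mids ++ perms)
    family-size : length family ≡ m + length (map matrix perms)
    family-size = begin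
      length family                 ≡⟨ Listₚ.length-map matrix (mids ++ perms) ⟩
      length (mids ++ perms)        ≡⟨ Listₚ.length-++ mids ⟩
      length mids + length perms    ≡⟨ cong₂ _+_ (trans (Listₚ.length-map mid (upTo m)) (Listₚ.length-upTo m))
                                                 (sym (Listₚ.length-map matrix perms)) ⟩
      m + length (map matrix perms) ∎
      where open ≡-Reasoning
    family-Ωth : All (Ωth N ∘ matrix) (mids ++ perms)
    family-Ωth = Allₚ.++⁺
      (Allₚ.map⁺ (Allₚ.applyUpTo⁺₂ id m λ r →
        hankelAverage-Ωth (transpose (lo r) (lo m)) (transpose-involutive (lo r) (lo m))))
      (All.map (λ {x} → reflection-Ωth {matrix x}) perms-reflection)
    members : All (Ωth N) family
    members = Allₚ.map⁺ family-Ωth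
    balanced : All (Balanced ∘ matrix) (mids ++ perms)
    balanced = All.map (λ {x} → Ωth⇒balanced {X = matrix x}) family-Ωth
    spans : ∀ X → Ωth N X → Σ (Fin (length family) → ℚ) λ a → combo family a ≈ₘ X
    spans X ΩX = echelon⇒spans Balanced (Balanced ∘ matrix)
      (λ {X} {x} b → IsSubspace.add balanced-subspace {X} {matrix x} b) (mids ++ perms) all-echelon balanced
      (λ R balR pivotsR → vanish {R} balR
        (λ r<m → All.lookup pivotsR (∈ₚ.∈-++⁺ˡ (∈ₚ.∈-map⁺ mid (∈ₚ.∈-upTo⁺ r<m))))
        (Allₚ.++⁻ʳ mids pivotsR))
      X (Ωth⇒balanced {X = X} ΩX)

theorem3p4 : (m : ℕ) → 1 ≤ m →
    IsBasisOfSpan (𝓑* m) SymHankPerm ×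
    HasAffineDim (Ωth (suc (2 * m))) (length (𝓑* m) + m ∸ 1)
theorem3p4 m@(suc k) 1≤m rewrite Main.𝓑*≡perms m =
  -- With m = k+1 the truncated `L + m ∸ 1` is L + k, whose successor is m + L. Solved for L this is
  -- dim - m + 1, where m = (n-1)/2.
  basis , dimension (trans (ℕₚ.+-comm m L) (trans (ℕₚ.+-suc L k) (cong (λ x → suc (x ∸ 1)) (sym (ℕₚ.+-suc L k)))))
  where
  open Main m
  L = length (map matrix perms)
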